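{- Let $\Sigma$ be a circuit signature with value set $V$, let $(\mathcal I,\lVert-\rVert)$ be a complete interpretation of $\Sigma$, and let $\le$ be a total order on $V$. Then $$[\![-]\!]^{\mathbf S}_{\mathcal I}\circ\lVert-\rVert^{\le}_{\mathcal I}\circ\langle\!\langle-\rangle\!\rangle_{\mathcal I}=\mathrm{id}_{\mathbf{Stream}_{\mathcal I}},$$ i.e. for all $m,n\in\mathbb N$ and every causal, finitely specified and $\bot$-preserving monotone stream function $f:(V^m)^\omega\to(V^n)^\omega$, the circuit $\lVert\langle\!\langle f\rangle\!\rangle_{\mathcal I}\rVert^{\le}_{\mathcal I}$ synthesised from the Mealy machine $\langle\!\langle f\rangle\!\rangle_{\mathcal I}$ of $f$ has denotation $f$.
   Context: CIRCUITS. A circuit signature $\Sigma=(V,\bullet,P,\mathrm{dom},\mathrm{cod})$ consists of a finite set $V$ of values, an element $\bullet\in V$, a set $P$ of primitive symbols and functions $\mathrm{dom},\mathrm{cod}:P\to\mathbb N$. A PROP is a strict symmetric monoidal category with objects the natural numbers and tensor on objects given by addition. $\mathbf{CCirc}_\Sigma$ (combinational circuits) is the PROP freely generated by $p:\mathrm{dom}(p)\to\mathrm{cod}(p)$ ($p\in P$), $\bullet:0\to1$, fork $1\to2$, join $2\to1$, stub $1\to0$. $\mathbf{SCirc}_\Sigma$ (sequential circuits) is the symmetric traced PROP freely generated by the same generators together with $v:0\to1$ for each $v\in V\setminus\{\bullet\}$ and a delay $\delta:1\to1$. Combinational circuits are regarded as sequential ones. Composition in diagrammatic order is written $;$, and the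 trace is $\mathrm{Tr}^x:\mathrm{Hom}(x+m,x+n)\to\mathrm{Hom}(m,n)$. Multi-wire versions $\bullet_n$, $\mathrm{fork}_n:n\to 2n$, $\mathrm{join}_n:2n\to n$, $\mathrm{stub}_n$, $\delta_n$ act wirewise, and a word $\bar v\in V^n$ gives a circuit $\bar v:0\to n$ (tensor of its values). For $\bar v\in V^n$ the register is $\mathrm{reg}_{\bar v}:=(\bar v\otimes\delta_n);\mathrm{join}_n:n\to n$. INTERPRETATION AND DENOTATION. An interpretation $\mathcal I=(\sqsubseteq,[\![-]\!])$ of $\Sigma$ is a lattice order $\sqsubseteq$ on $V$ with least element $\bot=\bullet$ and, for each $p\in P$, a monotone function $[\![p]\!]:V^{\mathrm{dom}(p)}\to V^{\mathrm{cod}(p)}$ preserving the all-$\bot$ tuple. $\top$ is the greatest element of $V$. $(V^m)^\omega$ is the set of streams (functions $\mathbb N\to V^m$), ordered pointwise. The denotation $[\![F]\!]^{\mathbf S}_{\mathcal I}:(V^m)^\omega\to(V^n)^\omega$ of $F:m\to n$ in $\mathbf{SCirc}_\Sigma$ is defined compositionally: $p$ acts as $[\![p]\!]$ at each time index; fork is $v\mapsto(v,v)$, join is $(v,w)\mapsto v\sqcup w$, stub is $v\mapsto()$, each at every time index; $\bullet$ is the constant stream $\bot$; $v$ is the stream $v,\bot,\bot,\dots$; $\delta$ sends $\sigma$ to $\bot,\sigma(0),\sigma(1),\dots$; composition is function composition, tensor is product, and $\mathrm{Tr}^x(f)(\sigma)=\pi_1(f(\mu,\sigma))$ with $\mu$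 the least fixed point of $\tau\mapsto\pi_0(f(\tau,\sigma))$. STREAM FUNCTIONS. $f:A^\omega\to B^\omega$ is causal if $f(\sigma)(i)$ depends only on $\sigma(0),\dots,\sigma(i)$. For causal $f$ and $a\in A$, the initial output is $f[a]=f(a::\sigma)(0)$ (any $\sigma$) and the derivative $f_a:A^\omega\to B^\omega$ sends $\sigma$ to the tail of $f(a::\sigma)$; derivatives iterate along words, $f_\varepsilon=f$, $f_{wa}=(f_w)_a$. $f$ is finitely specified if $\{f_w\mid w\in A^\star\}$ is finite, and $\bot$-preserving if it maps the constant-$\bot$ stream to the constant-$\bot$ stream. $\mathbf{Stream}_{\mathcal I}$ is the PROP with morphisms $m\to n$ the causal, finitely specified and $\bot$-preserving monotone functions $(V^m)^\omega\to(V^n)^\omega$. MEALY MACHINES. An initialised monotone $(V^m,V^n)$-Mealy machine is $(S,g,s_0)$ with $S$ a finite lattice with order $\preceq$, $s_0\in S$, and $g:S\times V^m\to S\times V^n$ monotone and $\bot$-preserving; write $g_0,g_1$ for the transition and output components. MEALY MACHINE OF $f$. $\langle\!\langle f\rangle\!\rangle_{\mathcal I}=(S,g,f)$, where $S$ is the least set of stream functions containing $f$ and closed under derivatives, ordered by $h\preceq h'$ iff $h(\sigma)\le h'(\sigma)$ for all $\sigma$; $g(h,a)=(h_a,h[a])$; the initial state is $f$. COMPLETE INTERPRETATION. For $\bar v\in V^k$ let $\bar v^{\infty}:=\mathrm{Tr}^k(\mathrm{reg}_{\bar v};\mathrm{fork}_k):0\to k$. A complete interpretation is a pair $(\mathcal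 I,\lVert-\rVert)$ where $\lVert-\rVert$ sends each monotone $\bot$-preserving function $f:V^m\to V^n$ to a sequential circuit $\lVert f\rVert:m\to n$ of the form $(\bar v^{\infty}\otimes\mathrm{id}_m);G$, with $G:k+m\to n$ combinational and $\bar v\in V^k$, such that $[\![\lVert f\rVert]\!]^{\mathbf S}_{\mathcal I}(\sigma)(i)=f(\sigma(i))$. ENCODING. For a set $S$ with a partial order $\preceq$ and a total order $\le$, listed as $r_0\le r_1\le\dots\le r_{k-1}$, the $\le$-encoding $\gamma_\le:S\to V^k$ is $\gamma_\le(s)(i)=\top$ if $r_i\preceq s$ and $\bot$ otherwise. MONOTONE COMPLETION. For a finite poset $A$ contained in a finite lattice $B$, a finite lattice $C$ and a monotone $h:A\to C$, the monotone $B$-completion $h_{\mathsf m}:B\to C$ is defined recursively by $h_{\mathsf m}(b)=h(b)$ if $b\in A$; $h_{\mathsf m}(\bot_B)=\bot_C$ if $\bot_B\notin A$; otherwise $h_{\mathsf m}(b)=\bigvee\{h_{\mathsf m}(b')\mid b'\le b,\ b'\ne b\}$. MONOTONE MEALY ENCODING. For a monotone Mealy machine $(S,g,s_0)$ with $k$ states and an encoding $\gamma_\le:S\to V^k$, the monotone Mealy encoding $\gamma_\le(g):V^k\times V^m\to V^k\times V^n$ is the $(V^k\times V^m)$-completion of the function $\gamma_\le[S]\times V^m\to V^k\times V^n$, $(\gamma_\le(s),\bar x)\mapsto(\gamma_\le(g_0(s,\bar x)),g_1(s,\bar x))$. CHOSEN STATE ORDER. Given the total order $\le$ on $V$, extend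 it to a total order $\le_\star$ on the set $(V^m)^\star$ of finite words using the lexicographic order. Let $S'$ be the set of accessible states of $S$; for $s\in S'$ let $t_s$ be the minimal element of the set of words that transition from $s_0$ to $s$. The chosen state order on $S'$ is $s\le_{S'}s'$ iff $t_s\le_\star t_{s'}$. SYNTHESIS. With $\gamma_\le$ the encoding for the chosen state order determined by $\le$, and $k$ its width, $\lVert(S,g,s_0)\rVert^{\le}_{\mathcal I}:=\mathrm{Tr}^k\big((\mathrm{reg}_{\gamma_\le(s_0)}\otimes\mathrm{id}_m);\lVert\gamma_\le(g)\rVert\big):m\to n$.
   Formalization: Words are ordered by length first and then lexicographically, since in the purely lexicographic order the minimal word t_s need not exist; the states of a Mealy machine need only form a finite poset and g need not preserve ⊥, since the machine of f may fail both. -}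

module Defs where

open import Data.Bool.Base using (if_then_else_)
open import Data.Empty using (⊥-elim)
open import Data.Fin.Base using (Fin)
import Data.Fin.Properties as Fin
open import Data.List.Base as List using (List; []; _∷_; _∷ʳ_; length; filter; foldl; foldr; cartesianProductWith; cartesianProduct; deduplicate)
import Data.List.Extrema
open import Data.List.Membership.Propositional using (_∈_; find; lose)
import Data.List.Membership.Propositional.Properties as Mem
import Data.List.Properties as ListP
open import Data.List.Relation.Binary.Permutation.Propositional using (↭-sym)
import Data.List.Relation.Binary.Permutation.Propositional.Properties as Perm
import Data.List.Relation.Binary.Lex.NonStrict as ListLex
open import Data.List.Relation.Unary.All as All using (All; []; _∷_)
import Data.List.Relation.Unary.All.Properties as AllP
open import Data.List.Relation.Unary.Any as Any using (Any; here; there)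
import Data.List.Relation.Unary.Any.Properties as AnyP
open import Data.List.Relation.Unary.Enumerates.Setoid using (IsEnumeration)
import Data.List.Sort
open import Data.Nat.Base using (ℕ; zero; suc; _+_; _≤_; _<_; z≤n; s≤s; s≤s⁻¹)
import Data.Nat.Properties as ℕ
open import Data.Nat.Induction using (<-wellFounded; <-rec)
open import Data.Product.Base using (∃; ∃₂; _×_; _,_; proj₁; proj₂)
open import Data.Product.Relation.Binary.Lex.NonStrict using (×-decTotalOrder)
open import Data.Sum.Base using (_⊎_; inj₁; inj₂)
open import Data.Unit.Base using (⊤; tt)
open import Data.Vec.Base as Vec using (Vec; []; _∷_; _++_; take; drop; replicate; zipWith)
import Data.Vec.Properties as VecP
import Data.Vec.Relation.Binary.Lex.NonStrict as VecLex
open import Data.Vec.Relation.Binary.Pointwise.Inductive as PW using (Pointwise; []; _∷_)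
open import Function.Base using (_∘_; _on_)
open import Function.Bundles using (_↔_; Inverse)
open import Function.Properties.Inverse using (↔⇒↣)
open import Induction.WellFounded using (Acc; acc; WellFounded; module Subrelation)
open import Level using (0ℓ)
open import Relation.Binary.Bundles using (DecPoset; DecTotalOrder)
open import Relation.Binary.Core using (Rel)
import Relation.Binary.Construct.On as On
open import Relation.Binary.Definitions using (DecidableEquality; tri<; tri≈; tri>)
open import Relation.Binary.Lattice.Structures using (IsBoundedLattice)
open import Relation.Binary.PropositionalEquality using (_≡_; _≢_; refl; sym; trans; cong; cong₂; subst; subst₂)
open import Relation.Binary.Structures using (IsTotalOrder)
open import Relation.Nullary using (¬_; Dec; yes; no; does)
open import Relation.Nullary.Decidable using (via-injection; map′; _×-dec_; _→-dec_; ¬?)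
open import Relation.Unary using (Pred; Decidable)

------------------------------------------------------------------------
-- Counting arguments over finite lists

module _ {A : Set} {P Q : Pred A 0ℓ} (P? : Decidable P) (Q? : Decidable Q)
         (Q⊆P : ∀ {x} → Q x → P x) where

  length-filter-≤ : ∀ xs → length (filter Q? xs) ≤ length (filter P? xs)
  length-filter-≤ []       = z≤n
  length-filter-≤ (x ∷ xs) with Q? x | P? x
  ... | yes q | yes p = s≤s (length-filter-≤ xs)
  ... | yes q | no ¬p = ⊥-elim (¬p (Q⊆P q))
  ... | no  _ | yes p = ℕ.m≤n⇒m≤1+n (length-filter-≤ xs)
  ... | no  _ | no  _ = length-filter-≤ xs

  length-filter-< : ∀ {x xs} → x ∈ xs → P x → ¬ Q x →
                    length (filter Q? xs) < length (filter P? xs)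
  length-filter-< {xs = x ∷ xs} (here refl) p ¬q with Q? x | P? x
  ... | yes q | _     = ⊥-elim (¬q q)
  ... | no  _ | yes _ = s≤s (length-filter-≤ xs)
  ... | no  _ | no ¬p = ⊥-elim (¬p p)
  length-filter-< {xs = y ∷ xs} (there x∈) p ¬q with Q? y | P? y
  ... | yes _ | yes _ = s≤s (length-filter-< x∈ p ¬q)
  ... | yes q | no ¬p = ⊥-elim (¬p (Q⊆P q))
  ... | no  _ | yes _ = ℕ.m≤n⇒m≤1+n (length-filter-< x∈ p ¬q)
  ... | no  _ | no  _ = length-filter-< x∈ p ¬q

-- A decreasing sequence of decidable subsets of a finite set has two equal
-- consecutive terms.
module _ {A : Set} (xs : List A) (P : ℕ → A → Set) (P? : ∀ d → Decidable (P d))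
         (decr : ∀ d {x} → P (suc d) x → P d x) where

  private
    search : ∀ N d → length (filter (P? d) xs) ≤ N →
             ∃ λ e → ∀ {x} → x ∈ xs → P e x → P (suc e) x
    search N d bound with All.all? (λ x → P? d x →-dec P? (suc d) x) xs
    ... | yes all = d , All.lookup all
    ... | no ¬all with find (AllP.¬All⇒Any¬ (λ x → P? d x →-dec P? (suc d) x) xs ¬all)
    ...   | x , x∈ , ¬p with P? d x
    ...     | no ¬pd = ⊥-elim (¬p (⊥-elim ∘ ¬pd))
    ...     | yes pd with N | ℕ.<-≤-trans (length-filter-< (P? d) (P? (suc d)) (decr d) x∈ pd (λ q → ¬p (λ _ → q))) bound
    ...       | suc N′ | lt = search N′ (suc d) (s≤s⁻¹ lt)

  stabilise : ∃ λ d → ∀ {x} → x ∈ xs → P d x → P (suc d) x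
  stabilise = search _ 0 ℕ.≤-refl

------------------------------------------------------------------------
-- Free PROPs and free symmetric traced PROPs

data Kind : Set where
  untraced traced : Kind

module FreePROP (Gen : ℕ → ℕ → Set) where

  infixr 5 _⨾_
  infixr 6 _⊗_

  data Term : Kind → ℕ → ℕ → Set where
    gen  : ∀ {κ m n} → Gen m n → Term κ m n
    id   : ∀ {κ} n → Term κ n n
    _⨾_  : ∀ {κ m n p} → Term κ m n → Term κ n p → Term κ m p
    _⊗_  : ∀ {κ m n p q} → Term κ m n → Term κ p q → Term κ (m + p) (n + q)
    swap : ∀ {κ} m n → Term κ (m + n) (n + m)
    Tr   : ∀ {m n} x → Term traced (x + m) (x + n) → Term traced m n

  -- Transport along equations between objects, such as the associativity of
  -- _+_ : the PROP is strict, but these equations are not all definitional.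
  cast : ∀ {κ m m′ n n′} → m ≡ m′ → n ≡ n′ → Term κ m n → Term κ m′ n′
  cast = subst₂ (Term _)

  infix 4 _≋_

  -- Morphisms of the free PROP are terms up to _≋_.
  data _≋_ : ∀ {κ m n} → Rel (Term κ m n) 0ℓ where
    ≋-refl  : ∀ {κ m n} {f : Term κ m n} → f ≋ f
    ≋-sym   : ∀ {κ m n} {f g : Term κ m n} → f ≋ g → g ≋ f
    ≋-trans : ∀ {κ m n} {f g h : Term κ m n} → f ≋ g → g ≋ h → f ≋ h
    ⨾-cong  : ∀ {κ m n p} {f f′ : Term κ m n} {g g′ : Term κ n p} →
              f ≋ f′ → g ≋ g′ → f ⨾ g ≋ f′ ⨾ g′
    ⊗-cong  : ∀ {κ m n p q} {f f′ : Term κ m n} {g g′ : Term κ p q} →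
              f ≋ f′ → g ≋ g′ → f ⊗ g ≋ f′ ⊗ g′
    Tr-cong : ∀ {m n} x {f g : Term traced (x + m) (x + n)} → f ≋ g → Tr x f ≋ Tr x g

    ⨾-identityˡ : ∀ {κ m n} {f : Term κ m n} → id m ⨾ f ≋ f
    ⨾-identityʳ : ∀ {κ m n} {f : Term κ m n} → f ⨾ id n ≋ f
    ⨾-assoc     : ∀ {κ m n p q} {f : Term κ m n} {g : Term κ n p} {h : Term κ p q} →
                  (f ⨾ g) ⨾ h ≋ f ⨾ (g ⨾ h)

    ⊗-id          : ∀ {κ} m n → id {κ} m ⊗ id n ≋ id (m + n)
    ⊗-interchange : ∀ {κ m n p m′ n′ p′} {f : Term κ m n} {g : Term κ n p}
                    {f′ : Term κ m′ n′} {g′ : Term κ n′ p′} →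
                    (f ⨾ g) ⊗ (f′ ⨾ g′) ≋ (f ⊗ f′) ⨾ (g ⊗ g′)
    ⊗-identityˡ   : ∀ {κ m n} {f : Term κ m n} → id 0 ⊗ f ≋ f
    ⊗-identityʳ   : ∀ {κ m n} {f : Term κ m n} →
                    cast (ℕ.+-identityʳ m) (ℕ.+-identityʳ n) (f ⊗ id 0) ≋ f
    ⊗-assoc       : ∀ {κ m n p q r s} {f : Term κ m n} {g : Term κ p q} {h : Term κ r s} →
                    cast (ℕ.+-assoc m p r) (ℕ.+-assoc n q s) ((f ⊗ g) ⊗ h) ≋ f ⊗ (g ⊗ h)

    swap-natural    : ∀ {κ m n p q} {f : Term κ m n} {g : Term κ p q} →
                      (f ⊗ g) ⨾ swap n q ≋ swap m p ⨾ (g ⊗ f)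
    swap-involutive : ∀ {κ} m n → swap {κ} m n ⨾ swap n m ≋ id (m + n)
    swap-hexagon    : ∀ {κ} m n p →
                      cast (sym (ℕ.+-assoc m n p)) (ℕ.+-assoc n p m) (swap {κ} m (n + p))
                      ≋ cast refl (ℕ.+-assoc n m p) (swap m n ⊗ id p) ⨾ (id n ⊗ swap m p)

    Tr-tighten   : ∀ {m m′ n n′} x {g : Term traced m′ m} {f : Term traced (x + m) (x + n)}
                   {h : Term traced n n′} →
                   Tr x ((id x ⊗ g) ⨾ f ⨾ (id x ⊗ h)) ≋ g ⨾ Tr x f ⨾ h
    Tr-slide     : ∀ {m n} x y {f : Term traced (x + m) (y + n)} {g : Term traced y x} →
                   Tr x (f ⨾ (g ⊗ id n)) ≋ Tr y ((g ⊗ id m) ⨾ f)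
    Tr-vanish-0  : ∀ {m n} {f : Term traced m n} → Tr 0 f ≋ f
    Tr-vanish-+  : ∀ {m n} x y {f : Term traced ((x + y) + m) ((x + y) + n)} →
                   Tr (x + y) f ≋ Tr y (Tr x (cast (ℕ.+-assoc x y m) (ℕ.+-assoc x y n) f))
    Tr-superpose : ∀ {m n p q} x {f : Term traced (x + m) (x + n)} {g : Term traced p q} →
                   Tr x f ⊗ g ≋ Tr x (cast (ℕ.+-assoc x m p) (ℕ.+-assoc x n q) (f ⊗ g))
    Tr-yank      : ∀ x → Tr x (swap x x) ≋ id x

------------------------------------------------------------------------
-- Circuit signatures and circuits

record Signature : Set₁ where
  field
    V       : Set
    ∣V∣     : ℕ
    V↔Fin   : V ↔ Fin ∣V∣
    •       : V
    P       : Set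
    dom cod : P → ℕ

  infix 4 _≟_
  _≟_ : DecidableEquality V
  _≟_ = via-injection (↔⇒↣ V↔Fin) Fin._≟_

module Circuits (Sig : Signature) where
  open Signature Sig

  data CGen : ℕ → ℕ → Set where
    prim : (p : P) → CGen (dom p) (cod p)
    bot  : CGen 0 1
    fork : CGen 1 2
    join : CGen 2 1
    stub : CGen 1 0

  data SGen : ℕ → ℕ → Set where
    comb  : ∀ {m n} → CGen m n → SGen m n
    value : (v : V) → .(v ≢ •) → SGen 0 1
    delay : SGen 1 1

  private module C = FreePROP CGen
  open FreePROP SGen

  CCirc : ℕ → ℕ → Set
  CCirc = C.Term untraced

  SCirc : ℕ → ℕ → Set
  SCirc = Term traced

  ⌈_⌉ : ∀ {m n} → CCirc m n → SCirc m n
  ⌈ C.gen g ⌉    = gen (comb g)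
  ⌈ C.id n ⌉     = id n
  ⌈ f C.⨾ g ⌉    = ⌈ f ⌉ ⨾ ⌈ g ⌉
  ⌈ f C.⊗ g ⌉    = ⌈ f ⌉ ⊗ ⌈ g ⌉
  ⌈ C.swap m n ⌉ = swap m n

  -- The circuit of a single value; the value • is the generator bot.
  value₁ : V → SCirc 0 1
  value₁ v with v ≟ •
  ... | yes _  = gen (comb bot)
  ... | no v≢• = gen (value v v≢•)

  values : ∀ {n} → Vec V n → SCirc 0 n
  values []       = id 0
  values (v ∷ vs) = value₁ v ⊗ values vs

  delays : ∀ n → SCirc n n
  delays zero    = id 0
  delays (suc n) = gen delay ⊗ delays n

  -- fork_{1+n} = (fork ⊗ fork_n) ; (id_1 ⊗ swap_{1,n} ⊗ id_n), so that
  -- the two copies of the bundle of wires end up side by side.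
  forks : ∀ n → SCirc n (n + n)
  forks zero    = id 0
  forks (suc n) = (gen (comb fork) ⊗ forks n)
                ⨾ cast refl (cong suc (ℕ.+-assoc n 1 n)) (id 1 ⊗ (swap 1 n ⊗ id n))

  joins : ∀ n → SCirc (n + n) n
  joins zero    = id 0
  joins (suc n) = cast (cong suc (ℕ.+-assoc n 1 n)) refl (id 1 ⊗ (swap n 1 ⊗ id n))
                ⨾ (gen (comb join) ⊗ joins n)

  reg : ∀ {n} → Vec V n → SCirc n n
  reg {n} v = (values v ⊗ delays n) ⨾ joins n

  infix 8 _^∞
  _^∞ : ∀ {k} → Vec V k → SCirc 0 k
  _^∞ {k} v = Tr k (cast (sym (ℕ.+-identityʳ k)) refl (reg v ⨾ forks k))

------------------------------------------------------------------------
-- Tuples ordered componentwise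

module Tuples {V : Set} (_⊑_ : Rel V 0ℓ) (⊥ : V) where

  infix 4 _⊑ᵛ_
  _⊑ᵛ_ : ∀ {n} → Rel (Vec V n) 0ℓ
  _⊑ᵛ_ = Pointwise _⊑_

  ⊥ᵛ : ∀ {n} → Vec V n
  ⊥ᵛ = replicate _ ⊥

  record MonotoneFun (m n : ℕ) : Set where
    field
      fun         : Vec V m → Vec V n
      monotone    : ∀ {x y} → x ⊑ᵛ y → fun x ⊑ᵛ fun y
      ⊥-preserving : fun ⊥ᵛ ≡ ⊥ᵛ

------------------------------------------------------------------------
-- Interpretations

record Interpretation (Sig : Signature) : Set₁ where
  open Signature Sig
  infix 4 _⊑_
  field
    _⊑_              : Rel V 0ℓ
    _⊔_ _⊓_          : V → V → V
    ⊤ᴵ               : V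
    isBoundedLattice : IsBoundedLattice _≡_ _⊑_ _⊔_ _⊓_ ⊤ᴵ •

  open Tuples _⊑_ • public

  field
    ⟦_⟧ₚ : (p : P) → MonotoneFun (dom p) (cod p)

module Semantics (Sig : Signature) (I : Interpretation Sig) where
  open Signature Sig
  open Interpretation I
  open Circuits Sig
  open FreePROP SGen
  private module L = IsBoundedLattice isBoundedLattice

  ----------------------------------------------------------------------
  -- The finite lattices V^n

  _⊑?_ : ∀ x y → Dec (x ⊑ y)
  x ⊑? y = map′ (λ e → subst (x ⊑_) e (proj₁ (L.supremum x y)))
                (λ x⊑y → L.antisym (proj₂ (proj₂ (L.supremum x y)) y x⊑y L.refl)
                                   (proj₁ (proj₂ (L.supremum x y))))
                (x ⊔ y ≟ y)

  infix 4 _⊑ᵛ?_ _≟ᵛ_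
  _⊑ᵛ?_ : ∀ {n} (x y : Vec V n) → Dec (x ⊑ᵛ y)
  _⊑ᵛ?_ = PW.decidable _⊑?_

  _≟ᵛ_ : ∀ {n} → DecidableEquality (Vec V n)
  _≟ᵛ_ = VecP.≡-dec _≟_

  ⊑ᵛ-refl : ∀ {n} {x : Vec V n} → x ⊑ᵛ x
  ⊑ᵛ-refl = PW.refl L.refl

  ⊑ᵛ-reflexive : ∀ {n} {x y : Vec V n} → x ≡ y → x ⊑ᵛ y
  ⊑ᵛ-reflexive refl = ⊑ᵛ-refl

  ⊑ᵛ-trans : ∀ {n} {x y z : Vec V n} → x ⊑ᵛ y → y ⊑ᵛ z → x ⊑ᵛ z
  ⊑ᵛ-trans = PW.trans L.trans

  ⊑ᵛ-antisym : ∀ {n} {x y : Vec V n} → x ⊑ᵛ y → y ⊑ᵛ x → x ≡ y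
  ⊑ᵛ-antisym []       []       = refl
  ⊑ᵛ-antisym (p ∷ ps) (q ∷ qs) = cong₂ _∷_ (L.antisym p q) (⊑ᵛ-antisym ps qs)

  ⊥ᵛ-least : ∀ {n} (x : Vec V n) → ⊥ᵛ ⊑ᵛ x
  ⊥ᵛ-least []       = []
  ⊥ᵛ-least (v ∷ vs) = L.minimum v ∷ ⊥ᵛ-least vs

  ⊤ᵛ : ∀ {n} → Vec V n
  ⊤ᵛ = replicate _ ⊤ᴵ

  ⊤ᵛ-greatest : ∀ {n} (x : Vec V n) → x ⊑ᵛ ⊤ᵛ
  ⊤ᵛ-greatest []       = []
  ⊤ᵛ-greatest (v ∷ vs) = L.maximum v ∷ ⊤ᵛ-greatest vs

  infixr 6 _⊔ᵛ_
  _⊔ᵛ_ : ∀ {n} → Vec V n → Vec V n → Vec V n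
  _⊔ᵛ_ = zipWith _⊔_

  ⊔ᵛ-upperˡ : ∀ {n} (x y : Vec V n) → x ⊑ᵛ x ⊔ᵛ y
  ⊔ᵛ-upperˡ []       []       = []
  ⊔ᵛ-upperˡ (x ∷ xs) (y ∷ ys) = proj₁ (L.supremum x y) ∷ ⊔ᵛ-upperˡ xs ys

  ⊔ᵛ-upperʳ : ∀ {n} (x y : Vec V n) → y ⊑ᵛ x ⊔ᵛ y
  ⊔ᵛ-upperʳ []       []       = []
  ⊔ᵛ-upperʳ (x ∷ xs) (y ∷ ys) = proj₁ (proj₂ (L.supremum x y)) ∷ ⊔ᵛ-upperʳ xs ys

  ⊔ᵛ-least : ∀ {n} {x y z : Vec V n} → x ⊑ᵛ z → y ⊑ᵛ z → x ⊔ᵛ y ⊑ᵛ z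
  ⊔ᵛ-least []       []       = []
  ⊔ᵛ-least (p ∷ ps) (q ∷ qs) = proj₂ (proj₂ (L.supremum _ _)) _ p q ∷ ⊔ᵛ-least ps qs

  ⊔ᵛ-mono : ∀ {n} {x x′ y y′ : Vec V n} → x ⊑ᵛ x′ → y ⊑ᵛ y′ → x ⊔ᵛ y ⊑ᵛ x′ ⊔ᵛ y′
  ⊔ᵛ-mono p q = ⊔ᵛ-least (⊑ᵛ-trans p (⊔ᵛ-upperˡ _ _)) (⊑ᵛ-trans q (⊔ᵛ-upperʳ _ _))

  ⋁ : ∀ {n} → List (Vec V n) → Vec V n
  ⋁ = foldr _⊔ᵛ_ ⊥ᵛ

  ⋁-upper : ∀ {n} {x : Vec V n} {xs} → x ∈ xs → x ⊑ᵛ ⋁ xs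
  ⋁-upper {xs = x ∷ xs} (here refl) = ⊔ᵛ-upperˡ x (⋁ xs)
  ⋁-upper {xs = y ∷ xs} (there x∈)  = ⊑ᵛ-trans (⋁-upper x∈) (⊔ᵛ-upperʳ y (⋁ xs))

  ⋁-least : ∀ {n} {z : Vec V n} xs → (∀ {x} → x ∈ xs → x ⊑ᵛ z) → ⋁ xs ⊑ᵛ z
  ⋁-least []       _ = ⊥ᵛ-least _
  ⋁-least (x ∷ xs) b = ⊔ᵛ-least (b (here refl)) (⋁-least xs (b ∘ there))

  allV : List V
  allV = List.tabulate (Inverse.from V↔Fin)

  ∈-allV : ∀ v → v ∈ allV
  ∈-allV v = subst (_∈ allV) (Inverse.strictlyInverseʳ V↔Fin v)
                   (Mem.∈-tabulate⁺ (Inverse.to V↔Fin v))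

  tuples : ∀ n → List (Vec V n)
  tuples zero    = [] ∷ []
  tuples (suc n) = cartesianProductWith _∷_ allV (tuples n)

  ∈-tuples : ∀ {n} (x : Vec V n) → x ∈ tuples n
  ∈-tuples []       = here refl
  ∈-tuples (v ∷ vs) = Mem.∈-cartesianProductWith⁺ _∷_ (∈-allV v) (∈-tuples vs)

  take-mono : ∀ m {n} {x y : Vec V (m + n)} → x ⊑ᵛ y → take m x ⊑ᵛ take m y
  take-mono zero    p       = []
  take-mono (suc m) {x = _ ∷ _} {y = _ ∷ _} (p ∷ ps) = p ∷ take-mono m ps

  drop-mono : ∀ m {n} {x y : Vec V (m + n)} → x ⊑ᵛ y → drop m x ⊑ᵛ drop m y
  drop-mono zero    p       = p
  drop-mono (suc m) {x = _ ∷ _} {y = _ ∷ _} (p ∷ ps) = drop-mono m ps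

  ----------------------------------------------------------------------
  -- Streams and causal monotone stream functions

  Stream : ℕ → Set
  Stream n = ℕ → Vec V n

  infix 4 _≤ˢ_ _≡[_]_ _≈ˢ_ _≤ᶠ_
  _≤ˢ_ : ∀ {n} → Rel (Stream n) 0ℓ
  σ ≤ˢ τ = ∀ i → σ i ⊑ᵛ τ i

  _≡[_]_ : ∀ {n} → Stream n → ℕ → Stream n → Set
  σ ≡[ i ] τ = ∀ j → j ≤ i → σ j ≡ τ j

  record CausalFun (m n : ℕ) : Set where
    field
      fun      : Stream m → Stream n
      causal   : ∀ {σ τ} i → σ ≡[ i ] τ → fun σ i ≡ fun τ i
      monotone : ∀ {σ τ} → σ ≤ˢ τ → fun σ ≤ˢ fun τ

  open CausalFun

  _≈ˢ_ : ∀ {m n} → Rel (CausalFun m n) 0ℓ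
  f ≈ˢ g = ∀ σ i → fun f σ i ≡ fun g σ i

  _≤ᶠ_ : ∀ {m n} → Rel (CausalFun m n) 0ℓ
  f ≤ᶠ g = ∀ σ → fun f σ ≤ˢ fun g σ

  infixr 5 _∷ˢ_
  _∷ˢ_ : ∀ {n} → Vec V n → Stream n → Stream n
  (a ∷ˢ σ) zero    = a
  (a ∷ˢ σ) (suc i) = σ i

  ⊥ˢ : ∀ {n} → Stream n
  ⊥ˢ _ = ⊥ᵛ

  ----------------------------------------------------------------------
  -- Least fixed points

  record IsLeastFixedPoint {n} (φ : Stream n → Stream n) (μ : Stream n) : Set where
    field
      fixed : ∀ i → φ μ i ≡ μ i
      least : ∀ ν → (∀ i → φ ν i ≡ ν i) → μ ≤ˢ ν

  private
    module Iteration {n} (φ : Vec V n → Vec V n)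
                     (mono : ∀ {x y} → x ⊑ᵛ y → φ x ⊑ᵛ φ y) where

      iter : ℕ → Vec V n
      iter zero    = ⊥ᵛ
      iter (suc d) = φ (iter d)

      ascends : ∀ d → iter d ⊑ᵛ iter (suc d)
      ascends zero    = ⊥ᵛ-least _
      ascends (suc d) = mono (ascends d)

      stable = stabilise (tuples n) (λ d x → iter d ⊑ᵛ x) (λ d x → iter d ⊑ᵛ? x)
                         (λ d → ⊑ᵛ-trans (ascends d))

      lfp : Vec V n
      lfp = iter (proj₁ stable)

      lfp-fixed : φ lfp ≡ lfp
      lfp-fixed = ⊑ᵛ-antisym (proj₂ stable (∈-tuples lfp) ⊑ᵛ-refl) (ascends (proj₁ stable))

      lfp-least : ∀ {x} → φ x ⊑ᵛ x → lfp ⊑ᵛ x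
      lfp-least {x} p = go (proj₁ stable)
        where
        go : ∀ d → iter d ⊑ᵛ x
        go zero    = ⊥ᵛ-least x
        go (suc d) = ⊑ᵛ-trans (mono (go d)) p

    -- The least fixed point on streams is built one time index at a time.
    module StreamIteration {n} (φ : CausalFun n n) where

      put : ℕ → Vec V n → Stream n → Stream n
      put i a σ j with ℕ.<-cmp j i
      ... | tri< _ _ _ = σ j
      ... | tri≈ _ _ _ = a
      ... | tri> _ _ _ = ⊥ᵛ

      put-mono : ∀ i {a b σ} → a ⊑ᵛ b → put i a σ ≤ˢ put i b σ
      put-mono i p j with ℕ.<-cmp j i
      ... | tri< _ _ _ = ⊑ᵛ-refl
      ... | tri≈ _ _ _ = p
      ... | tri> _ _ _ = ⊑ᵛ-refl

      put-< : ∀ {i j a σ} → j < i → put i a σ j ≡ σ j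
      put-< {i} {j} j<i with ℕ.<-cmp j i
      ... | tri< _ _ _   = refl
      ... | tri≈ ¬< _ _  = ⊥-elim (¬< j<i)
      ... | tri> ¬< _ _  = ⊥-elim (¬< j<i)

      put-≡ : ∀ {i a σ} → put i a σ i ≡ a
      put-≡ {i} with ℕ.<-cmp i i
      ... | tri< _ ¬≡ _ = ⊥-elim (¬≡ refl)
      ... | tri≈ _ _ _  = refl
      ... | tri> _ ¬≡ _ = ⊥-elim (¬≡ refl)

      put-≤ : ∀ {i a σ ν} → (∀ j → j < i → σ j ⊑ᵛ ν j) → a ⊑ᵛ ν i → put i a σ ≤ˢ ν
      put-≤ {i} below at j with ℕ.<-cmp j i
      ... | tri< j<i _ _  = below j j<i
      ... | tri≈ _ refl _ = at
      ... | tri> _ _ _    = ⊥ᵛ-least _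

      module At (i : ℕ) (σ : Stream n) =
        Iteration (λ a → fun φ (put i a σ) i) (λ p → monotone φ (put-mono i p) i)

      approx : ℕ → Stream n
      approx zero    = ⊥ˢ
      approx (suc i) = put i (At.lfp i (approx i)) (approx i)

      μ : Stream n
      μ i = At.lfp i (approx i)

      approx≡μ : ∀ i j → j < i → approx i j ≡ μ j
      approx≡μ (suc i) j j<1+i with ℕ.m<1+n⇒m<n∨m≡n j<1+i
      ... | inj₁ j<i  = trans (put-< j<i) (approx≡μ i j j<i)
      ... | inj₂ refl = put-≡ {i}

      μ-fixed : ∀ i → fun φ μ i ≡ μ i
      μ-fixed i = trans (causal φ i (λ j j≤i → sym (approx≡μ (suc i) j (s≤s j≤i))))
                        (At.lfp-fixed i (approx i))

      μ-least : ∀ ν → fun φ ν ≤ˢ ν → μ ≤ˢ ν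
      μ-least ν pre = <-rec (λ i → μ i ⊑ᵛ ν i) step
        where
        step : ∀ i → (∀ {j} → j < i → μ j ⊑ᵛ ν j) → μ i ⊑ᵛ ν i
        step i ih = At.lfp-least i (approx i)
          (⊑ᵛ-trans (monotone φ (put-≤ (λ j j<i → ⊑ᵛ-trans (⊑ᵛ-reflexive (approx≡μ i j j<i)) (ih j<i)) ⊑ᵛ-refl) i)
                    (pre i))

  leastFixedPoint : ∀ {n} (φ : CausalFun n n) →
                    ∃ λ μ → IsLeastFixedPoint (fun φ) μ × (∀ ν → fun φ ν ≤ˢ ν → μ ≤ˢ ν)
  leastFixedPoint φ = μ , record { fixed = μ-fixed ; least = λ ν e → μ-least ν (⊑ᵛ-reflexive ∘ e) } , μ-least
    where open StreamIteration φ

  ----------------------------------------------------------------------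
  -- Denotation of sequential circuits

  infixr 5 _++ˢ_
  _++ˢ_ : ∀ {m n} → Stream m → Stream n → Stream (m + n)
  (σ ++ˢ τ) i = σ i ++ τ i

  takeˢ : ∀ m {n} → Stream (m + n) → Stream m
  takeˢ m σ i = take m (σ i)

  dropˢ : ∀ m {n} → Stream (m + n) → Stream n
  dropˢ m σ i = drop m (σ i)

  pointwise : ∀ {m n} (φ : Vec V m → Vec V n) → (∀ {x y} → x ⊑ᵛ y → φ x ⊑ᵛ φ y) → CausalFun m n
  pointwise φ mono = record
    { fun      = λ σ i → φ (σ i)
    ; causal   = λ i σ≡τ → cong φ (σ≡τ i ℕ.≤-refl)
    ; monotone = λ σ≤τ i → mono (σ≤τ i)
    }

  composeᶜ : ∀ {m n p} → CausalFun m n → CausalFun n p → CausalFun m p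
  composeᶜ f g = record
    { fun      = λ σ → fun g (fun f σ)
    ; causal   = λ i σ≡τ → causal g i (λ j j≤i → causal f j (λ k k≤j → σ≡τ k (ℕ.≤-trans k≤j j≤i)))
    ; monotone = λ σ≤τ → monotone g (monotone f σ≤τ)
    }

  tensorᶜ : ∀ {m n p q} → CausalFun m n → CausalFun p q → CausalFun (m + p) (n + q)
  tensorᶜ {m} f g = record
    { fun      = λ σ → fun f (takeˢ m σ) ++ˢ fun g (dropˢ m σ)
    ; causal   = λ i σ≡τ → cong₂ _++_ (causal f i (λ j j≤i → cong (take m) (σ≡τ j j≤i)))
                                      (causal g i (λ j j≤i → cong (drop m) (σ≡τ j j≤i)))
    ; monotone = λ σ≤τ i → PW.++⁺ (monotone f (λ j → take-mono m (σ≤τ j)) i)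
                                  (monotone g (λ j → drop-mono m (σ≤τ j)) i)
    }

  module _ {x m n} (f : CausalFun (x + m) (x + n)) where

    feedback : Stream m → CausalFun x x
    feedback σ = record
      { fun      = λ τ → takeˢ x (fun f (τ ++ˢ σ))
      ; causal   = λ i τ≡τ′ → cong (take x) (causal f i (λ j j≤i → cong (_++ σ j) (τ≡τ′ j j≤i)))
      ; monotone = λ τ≤τ′ i → take-mono x (monotone f (λ j → PW.++⁺ (τ≤τ′ j) ⊑ᵛ-refl) i)
      }

    private
      μ : Stream m → Stream x
      μ σ = proj₁ (leastFixedPoint (feedback σ))

      μ-fixed : ∀ σ i → fun (feedback σ) (μ σ) i ≡ μ σ i
      μ-fixed σ = IsLeastFixedPoint.fixed (proj₁ (proj₂ (leastFixedPoint (feedback σ))))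

      μ-least : ∀ σ ν → fun (feedback σ) ν ≤ˢ ν → μ σ ≤ˢ ν
      μ-least σ = proj₂ (proj₂ (leastFixedPoint (feedback σ)))

      μ-mono : ∀ {σ σ′} → σ ≤ˢ σ′ → μ σ ≤ˢ μ σ′
      μ-mono {σ} {σ′} σ≤σ′ = μ-least σ (μ σ′) λ i →
        ⊑ᵛ-trans (take-mono x (monotone f (λ j → PW.++⁺ ⊑ᵛ-refl (σ≤σ′ j)) i))
                 (⊑ᵛ-reflexive (μ-fixed σ′ i))

      upTo : ℕ → Stream x → Stream x
      upTo i ν j with j ℕ.≤? i
      ... | yes _ = ν j
      ... | no  _ = ⊤ᵛ

      upTo-≤ : ∀ {i ν j} → j ≤ i → upTo i ν j ≡ ν j
      upTo-≤ {i} {ν} {j} j≤i with j ℕ.≤? i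
      ... | yes _  = refl
      ... | no j≰i = ⊥-elim (j≰i j≤i)

      μ-causal-≤ : ∀ {σ σ′} i → σ ≡[ i ] σ′ → ∀ j → j ≤ i → μ σ j ⊑ᵛ μ σ′ j
      μ-causal-≤ {σ} {σ′} i σ≡σ′ j j≤i =
        ⊑ᵛ-trans (μ-least σ ν pre j) (⊑ᵛ-reflexive (upTo-≤ j≤i))
        where
        ν = upTo i (μ σ′)

        pre : fun (feedback σ) ν ≤ˢ ν
        pre k with k ℕ.≤? i
        ... | no  _   = ⊤ᵛ-greatest _
        ... | yes k≤i = ⊑ᵛ-reflexive (trans
          (cong (take x) (causal f k (λ l l≤k → cong₂ _++_ (upTo-≤ (ℕ.≤-trans l≤k k≤i)) (σ≡σ′ l (ℕ.≤-trans l≤k k≤i)))))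
          (μ-fixed σ′ k))

      μ-causal : ∀ {σ σ′} i → σ ≡[ i ] σ′ → μ σ ≡[ i ] μ σ′
      μ-causal i σ≡σ′ j j≤i = ⊑ᵛ-antisym (μ-causal-≤ i σ≡σ′ j j≤i)
                                         (μ-causal-≤ i (λ k k≤i → sym (σ≡σ′ k k≤i)) j j≤i)

    traceᶜ : CausalFun m n
    traceᶜ = record
      { fun      = λ σ → dropˢ x (fun f (proj₁ (leastFixedPoint (feedback σ)) ++ˢ σ))
      ; causal   = λ i σ≡τ → cong (drop x) (causal f i λ j j≤i →
                     cong₂ _++_ (μ-causal i σ≡τ j j≤i) (σ≡τ j j≤i))
      ; monotone = λ σ≤τ i → drop-mono x (monotone f (λ j → PW.++⁺ (μ-mono σ≤τ j) (σ≤τ j)) i)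
      }

  ⟦_⟧ᶜ : ∀ {m n} → CGen m n → CausalFun m n
  ⟦ prim p ⟧ᶜ = pointwise (MonotoneFun.fun ⟦ p ⟧ₚ) (MonotoneFun.monotone ⟦ p ⟧ₚ)
  ⟦ bot ⟧ᶜ    = pointwise (λ _ → • ∷ []) (λ _ → ⊑ᵛ-refl)
  ⟦ fork ⟧ᶜ   = pointwise (λ { (v ∷ []) → v ∷ v ∷ [] }) (λ { (p ∷ []) → p ∷ p ∷ [] })
  ⟦ join ⟧ᶜ   = pointwise (λ { (v ∷ w ∷ []) → (v ⊔ w) ∷ [] })
                          (λ { (p ∷ q ∷ []) → ⊔ᵛ-mono (p ∷ []) (q ∷ []) })
  ⟦ stub ⟧ᶜ   = pointwise (λ _ → []) (λ _ → [])

  ⟦_⟧ˢ : ∀ {m n} → SGen m n → CausalFun m n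
  ⟦ comb g ⟧ˢ    = ⟦ g ⟧ᶜ
  ⟦ value v _ ⟧ˢ = record
    { fun      = λ _ → (v ∷ []) ∷ˢ ⊥ˢ
    ; causal   = λ _ _ → refl
    ; monotone = λ _ _ → ⊑ᵛ-refl
    }
  ⟦ delay ⟧ˢ     = record
    { fun      = ⊥ᵛ ∷ˢ_
    ; causal   = λ { zero _ → refl ; (suc i) σ≡τ → σ≡τ i (ℕ.n≤1+n i) }
    ; monotone = λ { _ zero → ⊑ᵛ-refl ; σ≤τ (suc i) → σ≤τ i }
    }

  ⟦_⟧ : ∀ {m n} → SCirc m n → CausalFun m n
  ⟦ gen g ⟧    = ⟦ g ⟧ˢ
  ⟦ id n ⟧     = pointwise (λ x → x) (λ p → p)
  ⟦ F ⨾ G ⟧    = composeᶜ ⟦ F ⟧ ⟦ G ⟧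
  ⟦ F ⊗ G ⟧    = tensorᶜ ⟦ F ⟧ ⟦ G ⟧
  ⟦ swap m n ⟧ = pointwise (λ x → drop m x ++ take m x) (λ p → PW.++⁺ (drop-mono m p) (take-mono m p))
  ⟦ Tr x F ⟧   = traceᶜ {x} ⟦ F ⟧

  ----------------------------------------------------------------------
  -- Derivatives and the morphisms of Stream

  Word : ℕ → Set
  Word m = List (Vec V m)

  initial : ∀ {m n} → CausalFun m n → Vec V m → Vec V n
  initial f a = fun f (a ∷ˢ ⊥ˢ) 0

  derivative : ∀ {m n} → CausalFun m n → Vec V m → CausalFun m n
  derivative f a = record
    { fun      = λ σ i → fun f (a ∷ˢ σ) (suc i)
    ; causal   = λ i σ≡τ → causal f (suc i) λ { zero _ → refl ; (suc j) j≤i → σ≡τ j (s≤s⁻¹ j≤i) }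
    ; monotone = λ σ≤τ i → monotone f (λ { zero → ⊑ᵛ-refl ; (suc j) → σ≤τ j }) (suc i)
    }

  derivatives : ∀ {m n} → CausalFun m n → Word m → CausalFun m n
  derivatives = foldl derivative

  record StreamMorphism (m n : ℕ) : Set where
    field
      causalFun         : CausalFun m n
      finitelySpecified : ∃ λ (ws : List (Word m)) →
                          ∀ w → ∃ λ w′ → w′ ∈ ws × derivatives causalFun w ≈ˢ derivatives causalFun w′
      ⊥-preserving      : ∀ i → fun causalFun ⊥ˢ i ≡ ⊥ᵛ

  ----------------------------------------------------------------------
  -- Monotone Mealy machines

  -- The states form a finite poset, not necessarily a lattice, and the
  -- transition function is not required to preserve ⊥: the derivatives of a
  -- stream function need not form a lattice under the pointwise order, and
  -- when they have a least element its transition at ⊥ may leave it.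
  record MealyMachine (m n : ℕ) : Set₁ where
    field
      states : DecPoset 0ℓ 0ℓ 0ℓ
    open DecPoset states public
      renaming (Carrier to S; _≤_ to _≼_; _≤?_ to _≼?_; _≟_ to _≟ₛ_)
      using (_≈_; module Eq; antisym; reflexive)
      renaming (trans to ≼-trans; refl to ≼-refl)
    field
      elements      : List S
      isEnumeration : IsEnumeration (DecPoset.Eq.setoid states) elements
      g₀            : S → Vec V m → S
      g₁            : S → Vec V m → Vec V n
      g₀-monotone   : ∀ {s s′ x x′} → s ≼ s′ → x ⊑ᵛ x′ → g₀ s x ≼ g₀ s′ x′
      g₁-monotone   : ∀ {s s′ x x′} → s ≼ s′ → x ⊑ᵛ x′ → g₁ s x ⊑ᵛ g₁ s′ x′
      s₀            : S

  ----------------------------------------------------------------------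
  -- The Mealy machine of a stream function

  data IsDerivative {m n} (f : CausalFun m n) : CausalFun m n → Set where
    self : IsDerivative f f
    step : ∀ {h} → IsDerivative f h → ∀ a → IsDerivative f (derivative h a)

  cons-cong : ∀ {m} {a b : Vec V m} {σ τ} → a ⊑ᵛ b → σ ≤ˢ τ → a ∷ˢ σ ≤ˢ b ∷ˢ τ
  cons-cong p q zero    = p
  cons-cong p q (suc i) = q i

  uncons : ∀ {m n} (f : CausalFun m n) σ i → fun f σ i ≡ fun f (σ 0 ∷ˢ (σ ∘ suc)) i
  uncons f σ i = causal f i λ { zero _ → refl ; (suc j) _ → refl }

  uncons₀ : ∀ {m n} (f : CausalFun m n) σ → fun f σ 0 ≡ initial f (σ 0)
  uncons₀ f σ = causal f 0 λ { zero _ → refl ; (suc _) () }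

  -- h ≤ᶠ h′ as far as inputs of length d can tell.
  ≤-depth : ∀ {m n} → ℕ → CausalFun m n → CausalFun m n → Set
  ≤-depth zero    h h′ = ⊤
  ≤-depth (suc d) h h′ = ∀ a → initial h a ⊑ᵛ initial h′ a × ≤-depth d (derivative h a) (derivative h′ a)

  ≤-depth? : ∀ {m n} d (h h′ : CausalFun m n) → Dec (≤-depth d h h′)
  ≤-depth? zero    h h′ = yes tt
  ≤-depth? (suc d) h h′ = map′ (λ all a → All.lookup all (∈-tuples a)) (λ p → All.tabulate (λ {a} _ → p a))
    (All.all? (λ a → (initial h a ⊑ᵛ? initial h′ a) ×-dec ≤-depth? d (derivative h a) (derivative h′ a)) (tuples _))

  ≤-depth-pred : ∀ {m n} d {h h′ : CausalFun m n} → ≤-depth (suc d) h h′ → ≤-depth d h h′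
  ≤-depth-pred zero    p = tt
  ≤-depth-pred (suc d) p a = proj₁ (p a) , ≤-depth-pred d (proj₂ (p a))

  ≤-depth-resp : ∀ {m n} d (h h′ k k′ : CausalFun m n) → h ≈ˢ k → h′ ≈ˢ k′ → ≤-depth d h h′ → ≤-depth d k k′
  ≤-depth-resp zero    h h′ k k′ e e′ p = tt
  ≤-depth-resp (suc d) h h′ k k′ e e′ p a =
    subst₂ _⊑ᵛ_ (e _ 0) (e′ _ 0) (proj₁ (p a)) ,
    ≤-depth-resp d (derivative h a) (derivative h′ a) (derivative k a) (derivative k′ a) (λ σ i → e _ (suc i)) (λ σ i → e′ _ (suc i)) (proj₂ (p a))

  ≤ᶠ⇒≤-depth : ∀ {m n} d {h h′ : CausalFun m n} → h ≤ᶠ h′ → ≤-depth d h h′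
  ≤ᶠ⇒≤-depth zero    p   = tt
  ≤ᶠ⇒≤-depth (suc d) p a = p _ 0 , ≤ᶠ⇒≤-depth d (λ σ i → p _ (suc i))

  module _ {m n} (f : StreamMorphism m n) where
    open StreamMorphism f

    words : List (Word m)
    words = proj₁ finitelySpecified

    derivative-word : ∀ {h} → IsDerivative causalFun h → ∃ λ w → h ≡ derivatives causalFun w
    derivative-word self = [] , refl
    derivative-word (step p a) with derivative-word p
    ... | w , refl = w ∷ʳ a , sym (ListP.foldl-∷ʳ derivative causalFun a w)

    word-derivative : ∀ w → IsDerivative causalFun (derivatives causalFun w)
    word-derivative w = go w self
      where
      go : ∀ w {h} → IsDerivative causalFun h → IsDerivative causalFun (derivatives h w)
      go []      p = p
      go (a ∷ w) p = go w (step p a)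

    listed : List (∃ (IsDerivative causalFun))
    listed = List.map (λ w → derivatives causalFun w , word-derivative w) words

    covered : ∀ {h} → IsDerivative causalFun h → ∃ λ k → k ∈ listed × h ≈ˢ proj₁ k
    covered p with derivative-word p
    ... | w , refl with proj₂ finitelySpecified w
    ...   | w′ , w′∈ , e = _ , Mem.∈-map⁺ _ w′∈ , e

    depth-stable = stabilise (cartesianProduct listed listed)
      (λ { d ((h , _) , (h′ , _)) → ≤-depth d h h′ }) (λ { d ((h , _) , (h′ , _)) → ≤-depth? d h h′ })
      (λ d → ≤-depth-pred d)

    depth : ℕ
    depth = proj₁ depth-stable

    deepen : ∀ {h h′} → IsDerivative causalFun h → IsDerivative causalFun h′ →
             ≤-depth depth h h′ → ≤-depth (suc depth) h h′
    deepen {h} {h′} p p′ q with covered p | covered p′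
    ... | k , k∈ , e | k′ , k′∈ , e′ =
      ≤-depth-resp (suc depth) (proj₁ k) (proj₁ k′) h h′ (λ σ i → sym (e σ i)) (λ σ i → sym (e′ σ i))
        (proj₂ depth-stable (Mem.∈-cartesianProduct⁺ k∈ k′∈) (≤-depth-resp depth h h′ (proj₁ k) (proj₁ k′) e e′ q))

    ≤-depth⇒≤ᶠ : ∀ {h h′} → IsDerivative causalFun h → IsDerivative causalFun h′ →
                 ≤-depth depth h h′ → h ≤ᶠ h′
    ≤-depth⇒≤ᶠ {h} {h′} p p′ q σ zero =
      subst₂ _⊑ᵛ_ (sym (uncons₀ h σ)) (sym (uncons₀ h′ σ)) (proj₁ (deepen p p′ q (σ 0)))
    ≤-depth⇒≤ᶠ {h} {h′} p p′ q σ (suc i) =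
      subst₂ _⊑ᵛ_ (sym (uncons h σ (suc i))) (sym (uncons h′ σ (suc i)))
        (≤-depth⇒≤ᶠ (step p (σ 0)) (step p′ (σ 0)) (proj₂ (deepen p p′ q (σ 0))) (σ ∘ suc) i)

    _≤ᶠ?_ : (h h′ : ∃ (IsDerivative causalFun)) → Dec (proj₁ h ≤ᶠ proj₁ h′)
    (h , p) ≤ᶠ? (h′ , p′) = map′ (≤-depth⇒≤ᶠ p p′) (≤ᶠ⇒≤-depth depth) (≤-depth? depth h h′)

    derivativePoset : DecPoset 0ℓ 0ℓ 0ℓ
    derivativePoset = record
      { Carrier = ∃ (IsDerivative causalFun)
      ; _≈_     = _≈ˢ_ on proj₁
      ; _≤_     = _≤ᶠ_ on proj₁
      ; isDecPartialOrder = record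
        { isPartialOrder = record
          { isPreorder = record
            { isEquivalence = record
              { refl  = λ σ i → refl
              ; sym   = λ e σ i → sym (e σ i)
              ; trans = λ e e′ σ i → trans (e σ i) (e′ σ i)
              }
            ; reflexive = λ e σ i → ⊑ᵛ-reflexive (e σ i)
            ; trans     = λ p q σ i → ⊑ᵛ-trans (p σ i) (q σ i)
            }
          ; antisym = λ p q σ i → ⊑ᵛ-antisym (p σ i) (q σ i)
          }
        ; _≟_  = λ h h′ → map′ (λ { (p , q) σ i → ⊑ᵛ-antisym (p σ i) (q σ i) })
                               (λ e → (λ σ i → ⊑ᵛ-reflexive (e σ i)) , (λ σ i → ⊑ᵛ-reflexive (sym (e σ i))))
                               ((h ≤ᶠ? h′) ×-dec (h′ ≤ᶠ? h))
        ; _≤?_ = _≤ᶠ?_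
        }
      }

    ⟪_⟫ : MealyMachine m n
    ⟪_⟫ = record
      { states        = derivativePoset
      ; elements      = listed
      ; isEnumeration = λ { (h , p) → let k , k∈ , e = covered p in Any.map (λ { refl → e }) k∈ }
      ; g₀            = λ { (h , p) a → derivative h a , step p a }
      ; g₁            = λ { (h , _) a → initial h a }
      ; g₀-monotone   = λ { {h , _} p q σ i → ⊑ᵛ-trans (monotone h (cons-cong q (λ _ → ⊑ᵛ-refl)) (suc i)) (p _ (suc i)) }
      ; g₁-monotone   = λ { {h , _} p q → ⊑ᵛ-trans (monotone h (cons-cong q (λ _ → ⊑ᵛ-refl)) 0) (p _ 0) }
      ; s₀            = causalFun , self
      }

  ----------------------------------------------------------------------
  -- Monotone completion

  infix 4 _⊏ᵛ_
  _⊏ᵛ_ : ∀ {n} → Rel (Vec V n) 0ℓ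
  x ⊏ᵛ y = x ⊑ᵛ y × x ≢ y

  ⊏ᵛ-wellFounded : ∀ {n} → WellFounded (_⊏ᵛ_ {n})
  ⊏ᵛ-wellFounded {n} = Subrelation.wellFounded rank-< (On.wellFounded rank <-wellFounded)
    where
    rank : Vec V n → ℕ
    rank x = length (filter (_⊑ᵛ? x) (tuples n))

    rank-< : ∀ {x y} → x ⊏ᵛ y → rank x < rank y
    rank-< {x} {y} (x⊑y , x≢y) = length-filter-< (_⊑ᵛ? y) (_⊑ᵛ? x) (λ z⊑x → ⊑ᵛ-trans z⊑x x⊑y)
      (∈-tuples y) ⊑ᵛ-refl (λ y⊑x → x≢y (⊑ᵛ-antisym x⊑y y⊑x))

  strictlyBelow : ∀ {n} (b : Vec V n) → List (∃ (_⊏ᵛ b))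
  strictlyBelow {n} b = among (tuples n)
    module StrictlyBelow where
    among : List (Vec V n) → List (∃ (_⊏ᵛ b))
    among []        = []
    among (b′ ∷ bs) with (b′ ⊑ᵛ? b) ×-dec ¬? (b′ ≟ᵛ b)
    ... | yes b′⊏b = (b′ , b′⊏b) ∷ among bs
    ... | no  _    = among bs

    ∈-among : ∀ {b′ bs} → b′ ⊏ᵛ b → b′ ∈ bs → ∃ λ (p : b′ ⊏ᵛ b) → (b′ , p) ∈ among bs
    ∈-among {bs = c ∷ bs} q b′∈ with (c ⊑ᵛ? b) ×-dec ¬? (c ≟ᵛ b)
    ∈-among q (here refl) | yes p = p , here refl
    ∈-among q (here refl) | no ¬p = ⊥-elim (¬p q)
    ∈-among q (there b′∈) | yes _ = let p , p∈ = ∈-among q b′∈ in p , there p∈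
    ∈-among q (there b′∈) | no  _ = ∈-among q b′∈

  ∈-strictlyBelow : ∀ {n} {b b′ : Vec V n} → b′ ⊏ᵛ b → ∃ λ (p : b′ ⊏ᵛ b) → (b′ , p) ∈ strictlyBelow b
  ∈-strictlyBelow {b = b} {b′} b′⊏b = StrictlyBelow.∈-among b b′⊏b (∈-tuples b′)

  module Completion {p q : ℕ} {A : Pred (Vec V p) 0ℓ} (A? : Decidable A)
                    (h : ∀ b → A b → Vec V q) where

    complete-acc : ∀ b → Acc _⊏ᵛ_ b → Vec V q
    complete-acc b (acc below) with A? b
    ... | yes b∈A = h b b∈A
    ... | no  _   with b ≟ᵛ ⊥ᵛ
    ...   | yes _ = ⊥ᵛ
    ...   | no  _ = ⋁ (List.map (λ b′ → complete-acc (proj₁ b′) (below (proj₂ b′))) (strictlyBelow b))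

    complete : Vec V p → Vec V q
    complete b = complete-acc b (⊏ᵛ-wellFounded b)

    complete-acc-irrelevant : ∀ b (a a′ : Acc _⊏ᵛ_ b) → complete-acc b a ≡ complete-acc b a′
    complete-acc-irrelevant b (acc below) (acc below′) with A? b
    ... | yes _ = refl
    ... | no  _ with b ≟ᵛ ⊥ᵛ
    ...   | yes _ = refl
    ...   | no  _ = cong ⋁ (ListP.map-cong
      (λ b′ → complete-acc-irrelevant (proj₁ b′) (below (proj₂ b′)) (below′ (proj₂ b′))) (strictlyBelow b))

    module _ (h-mono : ∀ {b b′} (b∈A : A b) (b′∈A : A b′) → b ⊑ᵛ b′ → h b b∈A ⊑ᵛ h b′ b′∈A) where

      complete-acc-≤h : ∀ b (a : Acc _⊏ᵛ_ b) {b′} (b′∈A : A b′) → b ⊑ᵛ b′ → complete-acc b a ⊑ᵛ h b′ b′∈A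
      complete-acc-≤h b (acc below) b′∈A b⊑b′ with A? b
      ... | yes b∈A = h-mono b∈A b′∈A b⊑b′
      ... | no  _   with b ≟ᵛ ⊥ᵛ
      ...   | yes _ = ⊥ᵛ-least _
      ...   | no  _ = ⋁-least _ bound
        where
        bound : ∀ {c} → c ∈ List.map (λ b″ → complete-acc (proj₁ b″) (below (proj₂ b″))) (strictlyBelow b) →
                c ⊑ᵛ h _ b′∈A
        bound c∈ with Mem.∈-map⁻ _ c∈
        ... | (b″ , b″⊏b) , _ , refl =
          complete-acc-≤h b″ (below b″⊏b) b′∈A (⊑ᵛ-trans (proj₁ b″⊏b) b⊑b′)

      complete-acc-mono : ∀ {b b′} (a : Acc _⊏ᵛ_ b) (a′ : Acc _⊏ᵛ_ b′) → b ⊑ᵛ b′ →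
                          complete-acc b a ⊑ᵛ complete-acc b′ a′
      complete-acc-mono {b} {b′} a a′ b⊑b′ with b ≟ᵛ b′
      ... | yes refl = ⊑ᵛ-reflexive (complete-acc-irrelevant b a a′)
      complete-acc-mono {b} {b′} a (acc below′) b⊑b′ | no b≢b′ with A? b′
      ... | yes b′∈A = complete-acc-≤h b a b′∈A b⊑b′
      ... | no  _    with b′ ≟ᵛ ⊥ᵛ
      ...   | yes refl = ⊥-elim (b≢b′ (⊑ᵛ-antisym b⊑b′ (⊥ᵛ-least b)))
      ...   | no  _    with ∈-strictlyBelow {b = b′} (b⊑b′ , b≢b′)
      ...     | b⊏b′ , b∈ = ⊑ᵛ-trans (⊑ᵛ-reflexive (complete-acc-irrelevant b a (below′ b⊏b′)))
                                     (⋁-upper (Mem.∈-map⁺ _ b∈))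

      complete-mono : ∀ {b b′} → b ⊑ᵛ b′ → complete b ⊑ᵛ complete b′
      complete-mono = complete-acc-mono _ _

    complete-⊥ : (∀ ⊥∈A → h ⊥ᵛ ⊥∈A ≡ ⊥ᵛ) → complete ⊥ᵛ ≡ ⊥ᵛ
    complete-⊥ h-⊥ with ⊏ᵛ-wellFounded {p} ⊥ᵛ
    ... | acc _ with A? ⊥ᵛ
    ...   | yes ⊥∈A = h-⊥ ⊥∈A
    ...   | no  _   with _≟ᵛ_ {p} ⊥ᵛ ⊥ᵛ
    ...     | yes _ = refl
    ...     | no ≢  = ⊥-elim (≢ refl)

  ----------------------------------------------------------------------
  -- Encodings

  encoding : (S : DecPoset 0ℓ 0ℓ 0ℓ) (let open DecPoset S) (rs : List Carrier) →
             Carrier → Vec V (length rs)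
  encoding S rs s = Vec.map (λ r → if does (r ≤? s) then ⊤ᴵ else •) (Vec.fromList rs)
    where open DecPoset S

  module EncodingProperties (S : DecPoset 0ℓ 0ℓ 0ℓ) where
    open DecPoset S using (Carrier; _≈_; _≤?_; module Eq) renaming (_≤_ to _≼_; trans to ≼-trans; reflexive to ≼-reflexive)

    encoding-mono : ∀ rs {s s′} → s ≼ s′ → encoding S rs s ⊑ᵛ encoding S rs s′
    encoding-mono []       p = []
    encoding-mono (r ∷ rs) {s} {s′} p with r ≤? s | r ≤? s′
    ... | yes q | yes _ = L.refl ∷ encoding-mono rs p
    ... | yes q | no ¬q = ⊥-elim (¬q (≼-trans q p))
    ... | no  _ | yes _ = L.minimum _ ∷ encoding-mono rs p
    ... | no  _ | no  _ = L.refl ∷ encoding-mono rs p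

    encoding-reflects : ∀ rs {s} → Any (s ≈_) rs → ∀ (y : Vec V (length rs)) → encoding S rs s ⊑ᵛ y →
                        ⊤ᴵ ≡ • ⊎ (∀ s′ → y ≡ encoding S rs s′ → s ≼ s′)
    encoding-reflects (r ∷ rs) {s} (here s≈r) (y ∷ ys) (p ∷ ps) with r ≤? s
    ... | no r≰s = ⊥-elim (r≰s (≼-reflexive (Eq.sym s≈r)))
    ... | yes _ with ⊤ᴵ ≟ •
    ...   | yes e = inj₁ e
    ...   | no ¬e = inj₂ λ { s′ e → lemma s′ (cong Vec.head e) }
      where
      lemma : ∀ s′ → y ≡ (if does (r ≤? s′) then ⊤ᴵ else •) → s ≼ s′
      lemma s′ e with r ≤? s′
      ... | yes r≼s′ = ≼-trans (≼-reflexive s≈r) r≼s′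
      ... | no _     = ⊥-elim (¬e (L.antisym (subst (⊤ᴵ ⊑_) e p) (L.minimum _)))
    encoding-reflects (r ∷ rs) (there s∈) (y ∷ ys) (p ∷ ps) with encoding-reflects rs s∈ ys ps
    ... | inj₁ e = inj₁ e
    ... | inj₂ f = inj₂ λ s′ e → f s′ (cong Vec.tail e)

    encoding-≢⊥ : ∀ rs {s} → Any (s ≈_) rs → encoding S rs s ≡ ⊥ᵛ → ⊤ᴵ ≡ •
    encoding-≢⊥ (r ∷ rs) {s} (here s≈r) e with r ≤? s
    ... | yes _  = cong Vec.head e
    ... | no r≰s = ⊥-elim (r≰s (≼-reflexive (Eq.sym s≈r)))
    encoding-≢⊥ (r ∷ rs) (there s∈) e = encoding-≢⊥ rs s∈ (cong Vec.tail e)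

  all-equal : ⊤ᴵ ≡ • → ∀ {n} (x y : Vec V n) → x ⊑ᵛ y
  all-equal e []       []       = []
  all-equal e (x ∷ xs) (y ∷ ys) = L.trans (subst (x ⊑_) e (L.maximum x)) (L.minimum y) ∷ all-equal e xs ys

  ----------------------------------------------------------------------
  -- Complete interpretations

  record Completeness : Set where
    field
      ‖_‖         : ∀ {m n} → MonotoneFun m n → SCirc m n
      ‖‖-cong     : ∀ {m n} (f g : MonotoneFun m n) →
                    (∀ x → MonotoneFun.fun f x ≡ MonotoneFun.fun g x) → ‖ f ‖ ≋ ‖ g ‖
      normal-form : ∀ {m n} (f : MonotoneFun m n) →
                    ∃ λ k → ∃₂ λ (v : Vec V k) (G : CCirc (k + m) n) →
                    ‖ f ‖ ≋ (v ^∞ ⊗ id m) ⨾ ⌈ G ⌉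
      correct     : ∀ {m n} (f : MonotoneFun m n) (σ : Stream m) i →
                    fun ⟦ ‖ f ‖ ⟧ σ i ≡ MonotoneFun.fun f (σ i)

  ----------------------------------------------------------------------
  -- The total order on words

  module WordOrder {_≤ⱽ_ : Rel V 0ℓ} (≤ⱽ-isTotalOrder : IsTotalOrder _≡_ _≤ⱽ_) where
    private module T = IsTotalOrder ≤ⱽ-isTotalOrder

    _≤ⱽ?_ : ∀ x y → Dec (x ≤ⱽ y)
    x ≤ⱽ? y with T.total x y
    ... | inj₁ p = yes p
    ... | inj₂ q with x ≟ y
    ...   | yes e = yes (T.reflexive e)
    ...   | no ¬e = no (λ p → ¬e (T.antisym p q))

    valueOrder : DecTotalOrder 0ℓ 0ℓ 0ℓ
    valueOrder = record { isDecTotalOrder = record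
      { isTotalOrder = ≤ⱽ-isTotalOrder ; _≟_ = _≟_ ; _≤?_ = _≤ⱽ?_ } }

    -- Words are compared by length first and words of equal length
    -- lexicographically: in the purely lexicographic order a nonempty set of
    -- words need not have a minimal element.
    wordOrder : ℕ → DecTotalOrder 0ℓ 0ℓ 0ℓ
    wordOrder m = On.decTotalOrder
      (×-decTotalOrder ℕ.≤-decTotalOrder (ListLex.≤-decTotalOrder (VecLex.≤-decTotalOrder valueOrder m)))
      (λ (w : Word m) → length w , w)

    _≤⋆_ : ∀ {m} → Rel (Word m) 0ℓ
    _≤⋆_ {m} = DecTotalOrder._≤_ (wordOrder m)

  ----------------------------------------------------------------------
  -- Words of bounded length

  words≤ : ∀ {m} → ℕ → List (Word m)
  words≤ zero    = [] ∷ []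
  words≤ (suc d) = [] ∷ cartesianProductWith _∷_ (tuples _) (words≤ d)

  ∈-words≤⁺ : ∀ {m} d (w : Word m) → length w ≤ d → w ∈ words≤ d
  ∈-words≤⁺ zero    []      _       = here refl
  ∈-words≤⁺ (suc d) []      _       = here refl
  ∈-words≤⁺ (suc d) (a ∷ w) (s≤s p) =
    there (Mem.∈-cartesianProductWith⁺ _∷_ (∈-tuples a) (∈-words≤⁺ d w p))

  ∈-words≤⁻ : ∀ {m} d {w : Word m} → w ∈ words≤ d → length w ≤ d
  ∈-words≤⁻ zero    (here refl) = z≤n
  ∈-words≤⁻ (suc d) (here refl) = z≤n
  ∈-words≤⁻ (suc d) (there w∈) with Mem.∈-cartesianProductWith⁻ _∷_ (tuples _) (words≤ d) w∈
  ... | a , w , _ , w∈′ , refl = s≤s (∈-words≤⁻ d w∈′)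

  ----------------------------------------------------------------------
  -- Synthesis

  module Synthesis (complete : Completeness)
                   {_≤ⱽ_ : Rel V 0ℓ} (≤ⱽ-isTotalOrder : IsTotalOrder _≡_ _≤ⱽ_)
                   {m n : ℕ} (M : MealyMachine m n) where
    open Completeness complete
    open WordOrder ≤ⱽ-isTotalOrder
    open MealyMachine M renaming (_≈_ to _≈ₛ_)

    run : Word m → S
    run = foldl g₀ s₀

    S′ : Set
    S′ = ∃ λ s → ∃ λ w → run w ≈ₛ s

    accessible : DecPoset 0ℓ 0ℓ 0ℓ
    accessible = On.decPoset states (proj₁ {B = λ s → ∃ λ w → run w ≈ₛ s})

    g₀-cong : ∀ {s s′} a → s ≈ₛ s′ → g₀ s a ≈ₛ g₀ s′ a
    g₀-cong a e = antisym (g₀-monotone (reflexive e) ⊑ᵛ-refl) (g₀-monotone (reflexive (Eq.sym e)) ⊑ᵛ-refl)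

    run-∷ʳ : ∀ {s} w a → run w ≈ₛ s → run (w ∷ʳ a) ≈ₛ g₀ s a
    run-∷ʳ w a e = Eq.trans (Eq.reflexive (ListP.foldl-∷ʳ g₀ s₀ a w)) (g₀-cong a e)

    s₀′ : S′
    s₀′ = s₀ , [] , Eq.refl

    g₀′ : S′ → Vec V m → S′
    g₀′ (s , w , e) a = g₀ s a , w ∷ʳ a , run-∷ʳ w a e

    g₁′ : S′ → Vec V m → Vec V n
    g₁′ (s , _) = g₁ s

    -- t_s, with its defining property.
    leastWord : (s : S′) → ∃ λ t → run t ≈ₛ proj₁ s × (∀ w → run w ≈ₛ proj₁ s → t ≤⋆ w)
    leastWord (s , w₀ , e₀) = min w₀ candidates ,
        argmin-all (λ w → w) e₀ (AllP.all-filter reaches? (words≤ (length w₀))) , least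
      where
      open Data.List.Extrema (DecTotalOrder.totalOrder (wordOrder m))

      reaches? : Decidable (λ w → run w ≈ₛ s)
      reaches? w = run w ≟ₛ s

      candidates : List (Word m)
      candidates = filter reaches? (words≤ (length w₀))

      least : ∀ w → run w ≈ₛ s → min w₀ candidates ≤⋆ w
      least w e with length w ℕ.≤? length w₀
      ... | yes p = All.lookup (min≤xs w₀ candidates) (Mem.∈-filter⁺ reaches? (∈-words≤⁺ _ w p) e)
      ... | no ¬p = DecTotalOrder.trans (wordOrder m) {min w₀ candidates} {w₀} {w} (min≤⊤ w₀ candidates)
                      (inj₁ (ℕ.<⇒≤ (ℕ.≰⇒> ¬p) , ℕ.<⇒≢ (ℕ.≰⇒> ¬p)))

    chosenStateOrder : DecTotalOrder 0ℓ 0ℓ 0ℓ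
    chosenStateOrder = On.decTotalOrder (wordOrder m) (λ s → proj₁ (leastWord s))

    Within : ℕ → S → Set
    Within d s = ∃ λ w → length w ≤ d × run w ≈ₛ s

    within? : ∀ d s → Dec (Within d s)
    within? d s = map′ (λ p → let w , w∈ , e = find p in w , ∈-words≤⁻ d w∈ , e)
                       (λ { (w , p , e) → lose (∈-words≤⁺ d w p) e })
                       (Any.any? (λ w → run w ≟ₛ s) (words≤ d))

    radius-stable = stabilise elements (λ d s → ¬ Within d s) (λ d s → ¬? (within? d s))
      (λ { d ¬q (w , p , e) → ¬q (w , ℕ.m≤n⇒m≤1+n p , e) })

    radius : ℕ
    radius = proj₁ radius-stable

    within-step : ∀ {s} a → Within radius s → Within radius (g₀ s a)
    within-step {s} a (w , p , e) with find (isEnumeration (g₀ s a))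
    ... | r , r∈ , e′ with within? radius r
    ...   | yes (w′ , p′ , e″) = w′ , p′ , Eq.trans e″ (Eq.sym e′)
    ...   | no ¬q = ⊥-elim (proj₂ radius-stable r∈ ¬q
      (w ∷ʳ a , subst (_≤ suc radius) (sym (ListP.length-++ w {a ∷ []})) (subst (_≤ suc radius) (ℕ.+-comm 1 (length w)) (s≤s p)) ,
       Eq.trans (run-∷ʳ w a e) e′))

    within : ∀ w {s} → Within radius s → Within radius (foldl g₀ s w)
    within []      p = p
    within (a ∷ w) p = within w (within-step a p)

    reached : List S′
    reached = List.map (λ w → run w , w , Eq.refl) (words≤ radius)

    ∈-reached : ∀ (s : S′) → Any (λ r → proj₁ s ≈ₛ proj₁ r) reached
    ∈-reached (s , w , e) =
      let w′ , p , e′ = within w ([] , z≤n , Eq.refl)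
      in AnyP.map⁺ (lose (∈-words≤⁺ radius w′ p) (Eq.trans (Eq.sym e) (Eq.sym e′)))

    accessibleStates : List S′
    accessibleStates = deduplicate (DecPoset._≟_ accessible) reached

    -- r₀ ≤ r₁ ≤ … ≤ r_{k-1}
    listing : List S′
    listing = Data.List.Sort.sort chosenStateOrder accessibleStates

    ∈-listing : ∀ s → Any (DecPoset._≈_ accessible s) listing
    ∈-listing s = Perm.Any-resp-↭ (↭-sym (Data.List.Sort.sort-↭ chosenStateOrder accessibleStates))
      (AnyP.deduplicate⁺ (DecPoset._≟_ accessible) (λ e e′ → Eq.trans e′ (Eq.sym e)) (∈-reached s))

    k : ℕ
    k = length listing

    γ : S′ → Vec V k
    γ = encoding accessible listing

    Encoded : Pred (Vec V (k + m)) 0ℓ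
    Encoded b = ∃₂ λ (s : S′) (x : Vec V m) → b ≡ γ s ++ x

    open EncodingProperties accessible

    γ-cong : ∀ {s s′} → DecPoset._≈_ accessible s s′ → γ s ≡ γ s′
    γ-cong {s} {s′} e = ⊑ᵛ-antisym (encoding-mono listing {s} {s′} (reflexive e)) (encoding-mono listing {s′} {s} (reflexive (Eq.sym e)))

    encoded? : Decidable Encoded
    encoded? b = map′ to from (Any.any? (λ s → take k b ≟ᵛ γ s) listing)
      where
      to : Any (λ s → take k b ≡ γ s) listing → Encoded b
      to p = let s , _ , e = find p
             in s , drop k b , trans (sym (VecP.take++drop≡id k b)) (cong (_++ drop k b) e)

      from : Encoded b → Any (λ s → take k b ≡ γ s) listing
      from (s , x , refl) = Any.map
        (λ {r} e → trans (VecP.++-injectiveˡ (take k b) (γ s) (VecP.take++drop≡id k b)) (γ-cong {s} {r} e))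
        (∈-listing s)

    step′ : ∀ b → Encoded b → Vec V (k + n)
    step′ _ (s , x , _) = γ (g₀′ s x) ++ g₁′ s x

    step′-mono : ∀ {b b′} (p : Encoded b) (p′ : Encoded b′) → b ⊑ᵛ b′ → step′ b p ⊑ᵛ step′ b′ p′
    step′-mono (s , x , refl) (s′ , x′ , refl) b⊑b′ =
      conclude (encoding-reflects listing {s} (∈-listing s) (γ s′) (PW.++ˡ⁻ (γ s) (γ s′) b⊑b′))
      where
      x⊑x′ : x ⊑ᵛ x′
      x⊑x′ = PW.++ʳ⁻ (γ s) (γ s′) b⊑b′

      conclude : ⊤ᴵ ≡ • ⊎ (∀ s″ → γ s′ ≡ γ s″ → proj₁ s ≼ proj₁ s″) →
                 γ (g₀′ s x) ++ g₁′ s x ⊑ᵛ γ (g₀′ s′ x′) ++ g₁′ s′ x′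
      conclude (inj₁ e) = all-equal e _ _
      conclude (inj₂ f) = PW.++⁺ (encoding-mono listing {g₀′ s x} {g₀′ s′ x′} (g₀-monotone (f s′ refl) x⊑x′))
                                 (g₁-monotone (f s′ refl) x⊑x′)

    ⊥-++ : ∀ k {m} → ⊥ᵛ {k + m} ≡ ⊥ᵛ {k} ++ ⊥ᵛ {m}
    ⊥-++ zero    = refl
    ⊥-++ (suc k) = cong (• ∷_) (⊥-++ k)

    step′-⊥ : ∀ (p : Encoded ⊥ᵛ) → step′ ⊥ᵛ p ≡ ⊥ᵛ
    step′-⊥ (s , x , e) = ⊑ᵛ-antisym (all-equal ⊤≡⊥ _ _) (⊥ᵛ-least _)
      where
      ⊤≡⊥ : ⊤ᴵ ≡ •
      ⊤≡⊥ = encoding-≢⊥ listing {s} (∈-listing s)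
              (sym (VecP.++-injectiveˡ ⊥ᵛ (γ s) (trans (sym (⊥-++ k)) e)))

    -- γ_≤(g)
    monotoneEncoding : MonotoneFun (k + m) (k + n)
    monotoneEncoding = record
      { fun          = Completion.complete encoded? step′
      ; monotone     = Completion.complete-mono encoded? step′ step′-mono
      ; ⊥-preserving = Completion.complete-⊥ encoded? step′ step′-⊥
      }

    synthesise : SCirc m n
    synthesise = Tr k ((reg (γ s₀′) ⊗ id m) ⨾ ‖ monotoneEncoding ‖)

{-# OPTIONS --safe #-}
module Submission where

open import Defs
open import Data.Nat.Base using (ℕ; zero; suc; _+_)
import Data.Nat.Properties as ℕ
open import Data.Product.Base using (_,_; proj₁; proj₂)
open import Data.Vec.Base using (Vec; []; _∷_; _++_; take; drop)
import Data.Vec.Properties as VecP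
open import Induction.WellFounded using (Acc; acc)
open import Level using (0ℓ)
open import Relation.Binary.Core using (Rel)
open import Relation.Binary.PropositionalEquality using (_≡_; refl; sym; trans; cong; cong₂; subst; module ≡-Reasoning)
open import Relation.Binary.Structures using (IsTotalOrder)
open import Relation.Nullary using (Dec; yes; no)
open import Relation.Nullary.Negation using (contradiction)

-- Because the trace variable is only fed through a delay, the fixed point
-- equation determines the register contents one time index at a time: they
-- are the encodings of the successive states of the machine. On encodings the
-- monotone completion is the transition function itself, so the circuit
-- outputs g₁ at the current state, and for ⟪ f ⟫ the state at time i is the
-- derivative of f along the first i inputs.

-- Concatenation and transport of vectors.

module _ {A : Set} where

  take-++ : ∀ {m n} (x : Vec A m) (y : Vec A n) → take m (x ++ y) ≡ x
  take-++ {m} x y = VecP.++-injectiveˡ (take m (x ++ y)) x (VecP.take++drop≡id m (x ++ y))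

  drop-++ : ∀ {m n} (x : Vec A m) (y : Vec A n) → drop m (x ++ y) ≡ y
  drop-++ {m} x y = VecP.++-injectiveʳ (take m (x ++ y)) x (VecP.take++drop≡id m (x ++ y))

  -- `cast` on circuits is a `subst₂`, so denotations transport vectors by `subst`, while
  -- associativity of `_++_` is an equation over `Vec.cast`; the two transports agree.
  ++-assoc-subst : ∀ {m n o} (x : Vec A m) (y : Vec A n) (z : Vec A o) →
                   subst (Vec A) (sym (ℕ.+-assoc m n o)) (x ++ (y ++ z)) ≡ (x ++ y) ++ z
  ++-assoc-subst {m} {n} {o} x y z = trans
    (VecP.subst-is-cast (sym (ℕ.+-assoc m n o)) _)
    (VecP.cast-sym (ℕ.+-assoc m n o) (VecP.++-assoc-eqFree x y z))

  subst-sym-∷ : ∀ {m n} (e : m ≡ n) (a : A) (x : Vec A n) →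
                subst (Vec A) (sym (cong suc e)) (a ∷ x) ≡ a ∷ subst (Vec A) (sym e) x
  subst-sym-∷ refl a x = refl

module SynthesisCorrectness (Sig : Signature) (I : Interpretation Sig) where
  open Signature Sig
  open Interpretation I
  open Circuits Sig
  open FreePROP SGen
  open Semantics Sig I
  open CausalFun

  -- Denotation of the register.

  ⊔ᵛ-identityˡ : ∀ {n} (x : Vec V n) → ⊥ᵛ ⊔ᵛ x ≡ x
  ⊔ᵛ-identityˡ x = ⊑ᵛ-antisym (⊔ᵛ-least (⊥ᵛ-least x) ⊑ᵛ-refl) (⊔ᵛ-upperʳ ⊥ᵛ x)

  ⊔ᵛ-identityʳ : ∀ {n} (x : Vec V n) → x ⊔ᵛ ⊥ᵛ ≡ x
  ⊔ᵛ-identityʳ x = ⊑ᵛ-antisym (⊔ᵛ-least ⊑ᵛ-refl (⊥ᵛ-least x)) (⊔ᵛ-upperˡ x ⊥ᵛ)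

  -- With `m′` a variable, `e` can be matched with `refl`; at the concrete widths in `joins` it
  -- cannot.
  cast-domain : ∀ {m m′ n} (e : m ≡ m′) (F : SCirc m n) σ i →
                fun ⟦ cast e refl F ⟧ σ i ≡ fun ⟦ F ⟧ (λ j → subst (Vec V) (sym e) (σ j)) i
  cast-domain refl F σ i = refl

  ⟦value₁⟧ : ∀ v σ i → fun ⟦ value₁ v ⟧ σ i ≡ ((v ∷ []) ∷ˢ ⊥ˢ) i
  ⟦value₁⟧ v σ i       with v ≟ •
  -- `bot` denotes the constant stream of `•`, so only index 0 needs `v ≡ •`.
  ⟦value₁⟧ v σ zero    | yes v≡• = cong (_∷ []) (sym v≡•)
  ⟦value₁⟧ v σ (suc i) | yes _   = refl
  ⟦value₁⟧ v σ i       | no  _   = refl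

  ⟦values⟧ : ∀ {n} (v : Vec V n) σ i → fun ⟦ values v ⟧ σ i ≡ (v ∷ˢ ⊥ˢ) i
  -- Both sides lie in `Vec V 0`, whose only element is `[]`.
  ⟦values⟧ []       σ i with fun ⟦ values [] ⟧ σ i | (([] {A = V}) ∷ˢ ⊥ˢ) i
  ... | [] | [] = refl
  ⟦values⟧ (v ∷ vs) σ i = trans
    (cong₂ _++_ (⟦value₁⟧ v (takeˢ 0 σ) i) (⟦values⟧ vs (dropˢ 0 σ) i))
    (∷ˢ-++ i)
    where
    ∷ˢ-++ : ∀ i → ((v ∷ []) ∷ˢ ⊥ˢ) i ++ (vs ∷ˢ ⊥ˢ) i ≡ ((v ∷ vs) ∷ˢ ⊥ˢ) i
    ∷ˢ-++ zero    = refl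
    ∷ˢ-++ (suc i) = refl

  ⟦delays⟧ : ∀ n σ i → fun ⟦ delays n ⟧ σ i ≡ (⊥ᵛ ∷ˢ σ) i
  ⟦delays⟧ zero σ i with fun ⟦ delays 0 ⟧ σ i | (⊥ᵛ ∷ˢ σ) i
  ... | [] | [] = refl
  ⟦delays⟧ (suc n) σ i = trans
    (cong (fun ⟦ delay ⟧ˢ (takeˢ 1 σ) i ++_) (⟦delays⟧ n (dropˢ 1 σ) i))
    (∷ˢ-++ i)
    where
    ∷ˢ-++ : ∀ i → (⊥ᵛ ∷ˢ takeˢ 1 σ) i ++ (⊥ᵛ ∷ˢ dropˢ 1 σ) i ≡ (⊥ᵛ ∷ˢ σ) i
    ∷ˢ-++ zero    = refl
    ∷ˢ-++ (suc i) = VecP.take++drop≡id 1 (σ i)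

  -- Joining acts separately at each time index, so constraining `σ i` alone suffices, and the
  -- induction can pass to the shuffled input without its first two wires.
  ⟦joins⟧ : ∀ {n} (x y : Vec V n) σ i → σ i ≡ x ++ y → fun ⟦ joins n ⟧ σ i ≡ x ⊔ᵛ y
  ⟦joins⟧ {zero} [] [] σ i e = e
  ⟦joins⟧ {suc n} (a ∷ x) (b ∷ y) σ i e = cong₂ _++_
      (cong (λ z → fun ⟦ join ⟧ᶜ (λ _ → take 2 z) i) shuffled)
      (⟦joins⟧ x y (dropˢ 2 ρ) i (cong (drop 2) shuffled))
    where
    open ≡-Reasoning

    assoc = ℕ.+-assoc n 1 n

    middle : SCirc (1 + ((n + 1) + n)) (1 + ((1 + n) + n))
    middle = id 1 ⊗ (swap n 1 ⊗ id n)

    ρ : Stream (1 + ((1 + n) + n))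
    ρ = fun ⟦ cast (cong suc assoc) refl middle ⟧ σ

    -- `middle` only rewires: its output at `i` is determined by its input at `i`, here extended to
    -- a constant stream.
    act : Vec V (1 + ((n + 1) + n)) → Vec V (1 + ((1 + n) + n))
    act z = fun ⟦ middle ⟧ (λ _ → z) i

    swapped : drop n (take (n + 1) ((x ++ b ∷ []) ++ y)) ++ take n (take (n + 1) ((x ++ b ∷ []) ++ y)) ≡ b ∷ x
    swapped = trans
      (cong (λ z → drop n z ++ take n z) (take-++ (x ++ b ∷ []) y))
      (cong₂ _++_ (drop-++ x (b ∷ [])) (take-++ x (b ∷ [])))

    shuffled : ρ i ≡ a ∷ b ∷ (x ++ y)
    shuffled = begin
      ρ i                                                                 ≡⟨ cast-domain (cong suc assoc) middle σ i ⟩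
      act (subst (Vec V) (sym (cong suc assoc)) (σ i))                     ≡⟨ cong (λ z → act (subst (Vec V) (sym (cong suc assoc)) z)) e ⟩
      act (subst (Vec V) (sym (cong suc assoc)) (a ∷ (x ++ (b ∷ y))))      ≡⟨ cong act (subst-sym-∷ assoc a (x ++ b ∷ y)) ⟩
      act (a ∷ subst (Vec V) (sym assoc) (x ++ (b ∷ y)))                   ≡⟨ cong (λ z → act (a ∷ z)) (++-assoc-subst x (b ∷ []) y) ⟩
      act (a ∷ ((x ++ b ∷ []) ++ y))                                       ≡⟨ cong (a ∷_) (cong₂ _++_ swapped (drop-++ (x ++ b ∷ []) y)) ⟩
      a ∷ b ∷ (x ++ y)                                                    ∎

  -- At index 0 the delay contributes `⊥ᵛ`, at every later index `values v` does, so the join always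
  -- returns its other argument.
  ⟦reg⟧ : ∀ {n} (v : Vec V n) σ i → fun ⟦ reg v ⟧ σ i ≡ (v ∷ˢ σ) i
  ⟦reg⟧ {n} v σ i = trans
    (⟦joins⟧ ((v ∷ˢ ⊥ˢ) i) ((⊥ᵛ ∷ˢ σ) i) _ i
      (cong₂ _++_ (⟦values⟧ v (takeˢ 0 σ) i) (⟦delays⟧ n (dropˢ 0 σ) i)))
    (∷ˢ-⊔ᵛ i)
    where
    ∷ˢ-⊔ᵛ : ∀ i → (v ∷ˢ ⊥ˢ) i ⊔ᵛ (⊥ᵛ ∷ˢ σ) i ≡ (v ∷ˢ σ) i
    ∷ˢ-⊔ᵛ zero    = ⊔ᵛ-identityʳ v
    ∷ˢ-⊔ᵛ (suc i) = ⊔ᵛ-identityˡ (σ i)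

  -- Monotone completion on its original domain.

  module _ {p q} {A : Vec V p → Set} (A? : ∀ b → Dec (A b)) (h : ∀ b → A b → Vec V q)
           (h-mono : ∀ {b b′} (b∈A : A b) (b′∈A : A b′) → b ⊑ᵛ b′ → h b b∈A ⊑ᵛ h b′ b′∈A) where
    open Completion A? h

    h≤complete-acc : ∀ {b} (b∈A : A b) (a : Acc _⊏ᵛ_ b) → h b b∈A ⊑ᵛ complete-acc b a
    h≤complete-acc {b} b∈A (acc _) with A? b
    ... | yes b∈A′ = h-mono b∈A b∈A′ ⊑ᵛ-refl
    ... | no  b∉A  = contradiction b∈A b∉A

    -- The membership proof found by `A?` may differ from `b∈A`, and `h` takes it as an argument;
    -- monotonicity at `b ⊑ᵛ b`, used in both directions, makes the values agree.
    complete-extends : ∀ {b} (b∈A : A b) → complete b ≡ h b b∈A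
    complete-extends b∈A = ⊑ᵛ-antisym (complete-acc-≤h h-mono _ _ b∈A ⊑ᵛ-refl) (h≤complete-acc b∈A _)

  -- Feedback through a register.

  module RegisterFeedback {k m n} {S : Set} (γ : S → Vec V k)
      (next : S → Vec V m → S) (out : S → Vec V m → Vec V n)
      (φ : Vec V (k + m) → Vec V (k + n)) (φ-step : ∀ s x → φ (γ s ++ x) ≡ γ (next s x) ++ out s x)
      (s₀ : S) (G : SCirc (k + m) (k + n)) (⟦G⟧ : ∀ σ i → fun ⟦ G ⟧ σ i ≡ φ (σ i)) where

    stateAt : Stream m → ℕ → S
    stateAt σ zero    = s₀
    stateAt σ (suc i) = next (stateAt σ i) (σ i)

    body : SCirc (k + m) (k + n)
    body = (reg (γ s₀) ⊗ id m) ⨾ G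

    module _ (σ : Stream m) where
      private lfp = leastFixedPoint (feedback {k} ⟦ body ⟧ σ)

      μ : Stream k
      μ = proj₁ lfp

      register : Stream k
      register = fun ⟦ reg (γ s₀) ⟧ (takeˢ k (μ ++ˢ σ))

      register-∷ˢ : ∀ i → register i ≡ (γ s₀ ∷ˢ takeˢ k (μ ++ˢ σ)) i
      register-∷ˢ = ⟦reg⟧ (γ s₀) (takeˢ k (μ ++ˢ σ))

      -- `φ` is known on encoded states only, so the register contents at the same index enter as a
      -- hypothesis, which `register-state` supplies.
      body-step : ∀ i → register i ≡ γ (stateAt σ i) →
                  fun ⟦ body ⟧ (μ ++ˢ σ) i ≡ γ (stateAt σ (suc i)) ++ out (stateAt σ i) (σ i)
      body-step i e = begin
        fun ⟦ body ⟧ (μ ++ˢ σ) i                                ≡⟨ ⟦G⟧ _ i ⟩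
        φ (register i ++ drop k (μ i ++ σ i))                  ≡⟨ cong φ (cong₂ _++_ e (drop-++ (μ i) (σ i))) ⟩
        φ (γ (stateAt σ i) ++ σ i)                             ≡⟨ φ-step (stateAt σ i) (σ i) ⟩
        γ (stateAt σ (suc i)) ++ out (stateAt σ i) (σ i)       ∎
        where open ≡-Reasoning

      -- The delay makes induction on time possible: the register at `suc i` holds `μ i`, which the
      -- fixed-point equation expresses through the body at `i`.
      register-state : ∀ i → register i ≡ γ (stateAt σ i)
      register-state zero    = register-∷ˢ zero
      register-state (suc i) = begin
        register (suc i)                                           ≡⟨ register-∷ˢ (suc i) ⟩
        take k (μ i ++ σ i)                                        ≡⟨ take-++ (μ i) (σ i) ⟩
        μ i                                                        ≡⟨ IsLeastFixedPoint.fixed (proj₁ (proj₂ lfp)) i ⟨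
        take k (fun ⟦ body ⟧ (μ ++ˢ σ) i)                           ≡⟨ cong (take k) (body-step i (register-state i)) ⟩
        take k (γ (stateAt σ (suc i)) ++ out (stateAt σ i) (σ i))  ≡⟨ take-++ (γ (stateAt σ (suc i))) _ ⟩
        γ (stateAt σ (suc i))                                      ∎
        where open ≡-Reasoning

      ⟦Tr-body⟧ : ∀ i → fun ⟦ Tr k body ⟧ σ i ≡ out (stateAt σ i) (σ i)
      ⟦Tr-body⟧ i = trans (cong (drop k) (body-step i (register-state i)))
                          (drop-++ (γ (stateAt σ (suc i))) (out (stateAt σ i) (σ i)))

  -- Output of the synthesised circuit.

  module SynthesisOutput (complete : Completeness) {_≤_ : Rel V 0ℓ} (≤-isTotalOrder : IsTotalOrder _≡_ _≤_)
                         {m n} (M : MealyMachine m n) where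
    open Synthesis complete ≤-isTotalOrder M
    open Completeness complete

    monotoneEncoding-step : ∀ s x → MonotoneFun.fun monotoneEncoding (γ s ++ x) ≡ γ (g₀′ s x) ++ g₁′ s x
    monotoneEncoding-step s x = complete-extends encoded? step′ step′-mono {γ s ++ x} (s , x , refl)

    module Feedback = RegisterFeedback γ g₀′ g₁′ (MonotoneFun.fun monotoneEncoding) monotoneEncoding-step
      s₀′ ‖ monotoneEncoding ‖ (correct monotoneEncoding)

    open MealyMachine M using (S; s₀; g₀; g₁)

    -- `Feedback.stateAt` runs through accessible states, which carry access words; its first
    -- projection obeys the same recursion as `state`, so the two agree by induction on time.
    ⟦synthesise⟧ : (F : CausalFun m n) (state : Stream m → ℕ → S) →
                   (∀ σ → state σ 0 ≡ s₀) →
                   (∀ σ i → state σ (suc i) ≡ g₀ (state σ i) (σ i)) →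
                   (∀ σ i → g₁ (state σ i) (σ i) ≡ fun F σ i) →
                   ⟦ Synthesis.synthesise complete ≤-isTotalOrder M ⟧ ≈ˢ F
    ⟦synthesise⟧ F state state-zero state-suc output σ i = begin
      fun ⟦ synthesise ⟧ σ i                      ≡⟨ Feedback.⟦Tr-body⟧ σ i ⟩
      g₁ (proj₁ (Feedback.stateAt σ i)) (σ i)     ≡⟨ cong (λ s → g₁ s (σ i)) (stateAt-state i) ⟩
      g₁ (state σ i) (σ i)                        ≡⟨ output σ i ⟩
      fun F σ i                                   ∎
      where
      open ≡-Reasoning
      stateAt-state : ∀ i → proj₁ (Feedback.stateAt σ i) ≡ state σ i
      stateAt-state zero    = sym (state-zero σ)
      stateAt-state (suc i) = trans (cong (λ s → g₀ s (σ i)) (stateAt-state i)) (sym (state-suc σ i))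

  -- Derivatives along a stream.

  module _ {m n} (f : CausalFun m n) (σ : Stream m) where

    derivativeAt : ℕ → CausalFun m n
    derivativeAt zero    = f
    derivativeAt (suc i) = derivative (derivativeAt i) (σ i)

    -- Each derivative shifts time by one, so the case `suc i` at `j` reduces to `i` at `suc j`;
    -- hence `j` is general.
    derivativeAt-suffix : ∀ i j → fun (derivativeAt i) (λ l → σ (i + l)) j ≡ fun f σ (i + j)
    derivativeAt-suffix zero    j = refl
    derivativeAt-suffix (suc i) j = begin
      -- The two streams agree only pointwise; causality serves as the congruence.
      fun h (σ i ∷ˢ (λ l → σ (suc i + l))) (suc j)  ≡⟨ causal h (suc j) (λ { zero _ → cong σ (sym (ℕ.+-identityʳ i))
                                                                           ; (suc l) _ → cong σ (sym (ℕ.+-suc i l)) }) ⟩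
      fun h (λ l → σ (i + l)) (suc j)               ≡⟨ derivativeAt-suffix i (suc j) ⟩
      fun f σ (i + suc j)                           ≡⟨ cong (fun f σ) (ℕ.+-suc i j) ⟩
      fun f σ (suc i + j)                           ∎
      where
      open ≡-Reasoning
      h = derivativeAt i

    initial-derivativeAt : ∀ i → initial (derivativeAt i) (σ i) ≡ fun f σ i
    initial-derivativeAt i = begin
      initial h (σ i)               ≡⟨ cong (λ l → initial h (σ l)) (ℕ.+-identityʳ i) ⟨
      -- `initial` pads its input with `⊥ˢ`; by causality the actual suffix of `σ` gives the same
      -- output at 0.
      initial h (σ (i + 0))         ≡⟨ uncons₀ h (λ l → σ (i + l)) ⟨
      fun h (λ l → σ (i + l)) 0     ≡⟨ derivativeAt-suffix i 0 ⟩
      fun f σ (i + 0)               ≡⟨ cong (fun f σ) (ℕ.+-identityʳ i) ⟩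
      fun f σ i                     ∎
      where
      open ≡-Reasoning
      h = derivativeAt i

  isDerivative-derivativeAt : ∀ {m n} (f : CausalFun m n) σ i → IsDerivative f (derivativeAt f σ i)
  isDerivative-derivativeAt f σ zero    = self
  isDerivative-derivativeAt f σ (suc i) = step (isDerivative-derivativeAt f σ i) (σ i)

-- ⟪_⟫ is qualified because, with the alias from the local opening, the
-- conversion check would unfold the synthesised circuit of ⟪ f ⟫.
corollary3p81 : (Sig : Signature) (I : Interpretation Sig) →
    let open Signature Sig in
    let open Semantics Sig I in
    (complete : Completeness) (_≤_ : Rel V 0ℓ) (≤-isTotalOrder : IsTotalOrder _≡_ _≤_)
    (m n : ℕ) (f : StreamMorphism m n) →
    ⟦ Synthesis.synthesise complete ≤-isTotalOrder (Semantics.⟪_⟫ Sig I f) ⟧ ≈ˢ StreamMorphism.causalFun f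
corollary3p81 Sig I complete _ ≤-isTotalOrder m n f =
  SynthesisOutput.⟦synthesise⟧ complete ≤-isTotalOrder {m} {n} (Semantics.⟪_⟫ Sig I {m} {n} f) causalFun
    (λ σ i → derivativeAt causalFun σ i , isDerivative-derivativeAt causalFun σ i)
    -- Start and transitions of the machine compute to `self` and `step`, exactly as in
    -- `isDerivative-derivativeAt`.
    (λ σ → refl) (λ σ i → refl) (initial-derivativeAt causalFun)
  where
  open SynthesisCorrectness Sig I
  open Semantics.StreamMorphism f using (causalFun)
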